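{- There exists a randomized algorithm with the following guarantee. Let $S\in\mathbb{R}^{n\times n}$ be a non-strictly diagonally dominant matrix satisfying at least one of the following two conditions: (1) $S$ is non-singular; (2) $S$ is symmetric, and all its diagonal entries are non-zero and have the same sign. Let $b$ be any vector in the range of $S$. Given access to the $(S,b)$-oracle, the values of $\kappa_\infty(S)$, $\|b\|_\infty$ and $S_{\max}$, an error bound $\varepsilon>0$, and a vertex $u\in[n]$, the algorithm makes $$O\left(\frac{\kappa_\infty(S)^3}{\varepsilon^5}\log\frac{\kappa_\infty(S)}{\varepsilon}\right)$$ oracle queries and returns a random value $z_u$ such that, with probability at least $2/3$, $|z_u-z^*_u|<\varepsilon\|z^*\|_\infty$ (with $\le$ in place of $<$ in the degenerate case $z^*=0$), where $z^*=S^{ -1}b$. The constant hidden in $O(\cdot)$ is absolute.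
   Context: $[n]=\{1,\dots,n\}$. $S\in\mathbb{R}^{n\times n}$ is non-strictly diagonally dominant if $|S_{ii}|\ge\sum_{j\ne i}|S_{ij}|$ for all $i\in[n]$. $S_{\max}=\max_{i\in[n]}|S_{ii}|$. $\|\cdot\|_\infty$ on matrices is the operator norm induced by the vector $\infty$-norm (maximum absolute row sum). $S^{ -1}$ denotes the inverse if $S$ is non-singular; for singular symmetric $S=V\Sigma V^T$ (orthogonal diagonalization), $S^{ -1}$ denotes the pseudo-inverse $V\Sigma^{ -1}V^T$, where $\Sigma^{ -1}$ takes reciprocals of the non-zero diagonal entries of $\Sigma$ and leaves zeros unchanged. $\kappa_\infty(S)=\|S\|_\infty\|S^{ -1}\|_\infty$. The matrix $S$ is viewed as a weighted directed graph on $[n]$ with an edge $(u,v)$ of weight $S_{uv}$ whenever $u\ne v$ and $S_{uv}\neq 0$. $\Delta^{\mathrm{out}}_u$ is the number of out-edges of $u$, and $d^{\mathrm{out}}_u=\sum_{v\ne u}|S_{uv}|$. The $(S,b)$-oracle answers the following queries, each at unit cost (fresh independent randomness for each random walk query): 1. Vertex query: given $u\in[n]$, return $\Delta^{\mathrm{out}}_u$, $d^{\mathrm{out}}_u$, $S_{uu}$ and $b_u$. 2. Neighbor query: given $u\in[n]$ and $i\in[\Delta^{\mathrm{out}}_u]$, return the $i$-th out-neighbor of $u$ under a fixed but arbitrary ordering. 3. Random walk query: given $u\in[n]$, return a random out-neighbor $v\ne u$ chosen with probability proportional to $|S_{uv}|$, along with $S_{uv}$; if $u$ has no out-neighbors return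 a special symbol $\perp$. The query complexity is the number of oracle queries made. Inside the $O(\cdot)$ bound, $\log x$ is read as $\max\{1,\log x\}$. The algorithm works in exact real arithmetic and may use its own randomness. -}

module Defs where

open import Level using (0ℓ)
open import Algebra.Bundles using (CommutativeRing)
open import Algebra.Core using (Op₁; Op₂)
open import Algebra.Structures using (IsCommutativeRing)
open import Data.Bool.Base using (if_then_else_)
open import Data.Fin.Base using (Fin; toℕ; fromℕ<)
import Data.Fin.Properties as Fin
open import Data.List.Base using (List; []; _∷_; allFin; drop; filter; head; length; map)
open import Data.List.Extrema.Nat using (max)
open import Data.List.Relation.Binary.Permutation.Propositional using (_↭_)
open import Data.Maybe.Base using (Maybe; just; nothing; maybe)
open import Data.Nat.Base as ℕ using (ℕ; zero; suc)
import Data.Nat.Properties as ℕ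
open import Data.Product.Base using (∃; _×_; _,_; proj₁)
open import Data.Sum.Base using (_⊎_; inj₁; inj₂)
open import Data.Vec.Functional using (Vector; foldr)
open import Relation.Binary.Bundles using (DecTotalOrder)
open import Relation.Binary.Core using (Rel)
import Relation.Binary.Construct.NonStrictToStrict as NonStrictToStrict
open import Relation.Binary.PropositionalEquality
  using (_≡_; _≢_; refl; sym; trans; cong; cong₂; subst; subst₂)
open import Relation.Binary.Structures using (IsDecTotalOrder)
open import Relation.Nullary using (¬_; Dec; yes; no; does; contradiction)
open import Relation.Nullary.Decidable using (¬?; _×-dec_; _⊎-dec_)
open import Relation.Unary using (Pred; Decidable)

record OrderedField : Set₁ where
  infix  8 -_ _⁻¹
  infixl 7 _*_
  infixl 6 _+_
  infix  4 _≤_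
  field
    ℝ       : Set
    _+_ _*_ : Op₂ ℝ
    -_      : Op₁ ℝ
    0# 1#   : ℝ
    _⁻¹     : Op₁ ℝ  -- unspecified at 0#
    _≤_     : Rel ℝ 0ℓ
    isCommutativeRing : IsCommutativeRing _≡_ _+_ _*_ -_ 0# 1#
    0≢1               : 0# ≢ 1#
    *-inverseʳ        : ∀ {x} → x ≢ 0# → x * x ⁻¹ ≡ 1#
    isDecTotalOrder   : IsDecTotalOrder _≡_ _≤_
    +-monoʳ-≤         : ∀ x {y z} → y ≤ z → x + y ≤ x + z
    *-nonNeg          : ∀ {x y} → 0# ≤ x → 0# ≤ y → 0# ≤ x * y

  commutativeRing : CommutativeRing 0ℓ 0ℓ
  commutativeRing = record { isCommutativeRing = isCommutativeRing }

  decTotalOrder : DecTotalOrder 0ℓ 0ℓ 0ℓ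
  decTotalOrder = record { isDecTotalOrder = isDecTotalOrder }

  open CommutativeRing commutativeRing public using (semiring; +-monoid)
  open DecTotalOrder decTotalOrder public
    using (_≟_; _≤?_; total; totalOrder)
    renaming ( refl to ≤-refl; trans to ≤-trans; antisym to ≤-antisym
             ; reflexive to ≤-reflexive )
  open NonStrictToStrict _≡_ _≤_ public using (_<_; <-decidable)
  open import Algebra.Construct.NaturalChoice.Max totalOrder public using (_⊔_)
  open import Algebra.Properties.Monoid.Sum +-monoid public using (sum)
  open import Algebra.Properties.Semiring.Exp semiring public using (_^_)
  open import Algebra.Properties.Semiring.Mult semiring public
    using () renaming (_×_ to _×ℕ_)

  infixl 7 _/_
  infixl 6 _-_
  infix  4 _<?_

  _-_ : Op₂ ℝ
  x - y = x + (- y)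

  _/_ : Op₂ ℝ
  x / y = x * y ⁻¹

  ∣_∣ : Op₁ ℝ
  ∣ x ∣ = x ⊔ (- x)

  _<?_ : ∀ x y → Dec (x < y)
  _<?_ = <-decidable _≟_ _≤?_

  fromℕ : ℕ → ℝ
  fromℕ n = n ×ℕ 1#

  UpperBound : Pred ℝ 0ℓ → Pred ℝ 0ℓ
  UpperBound P u = ∀ {x} → P x → x ≤ u

  IsSupremum : Pred ℝ 0ℓ → Pred ℝ 0ℓ
  IsSupremum P s = UpperBound P s × (∀ {u} → UpperBound P u → s ≤ u)

-- The real numbers, axiomatised as a Dedekind-complete ordered field (unique up
-- to isomorphism in classical mathematics, which is also why the order is taken
-- to be decidable).  The Archimedean property follows from completeness by
-- excluded middle; it is a field because the ambient logic is constructive.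
record Reals : Set₁ where
  field
    orderedField : OrderedField
  open OrderedField orderedField public
  field
    archimedean : ∀ x → ∃ λ n → x ≤ fromℕ n
    supremum    : ∀ P → ∃ P → ∃ (UpperBound P) → ∃ (IsSupremum P)

module OrderedFieldLemmas (F : OrderedField) where
  open OrderedField F
  open CommutativeRing commutativeRing
    using ( +-comm; +-assoc; +-identityˡ; +-identityʳ; -‿inverseˡ; -‿inverseʳ
          ; *-comm; *-identityˡ; *-identityʳ; distribˡ; distribʳ; zeroˡ; ring )
  open import Algebra.Properties.Ring ring
    using (-‿distribˡ-*; -‿distribʳ-*; -‿involutive)
  import Algebra.Properties.Semiring.Mult semiring as Mult

  +-cancel : ∀ x y → (x + y) + (- y) ≡ x
  +-cancel x y =
    trans (+-assoc x y (- y)) (trans (cong (x +_) (-‿inverseʳ y)) (+-identityʳ x))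

  +-monoˡ-≤ : ∀ z {x y} → x ≤ y → x + z ≤ y + z
  +-monoˡ-≤ z {x} {y} p = subst₂ _≤_ (+-comm z x) (+-comm z y) (+-monoʳ-≤ z p)

  +-mono-≤ : ∀ {x y u v} → x ≤ y → u ≤ v → x + u ≤ y + v
  +-mono-≤ {x} {y} {u} p q = ≤-trans (+-monoˡ-≤ u p) (+-monoʳ-≤ y q)

  0≤y-x : ∀ {x y} → x ≤ y → 0# ≤ y - x
  0≤y-x {x} p = subst (_≤ _) (-‿inverseʳ x) (+-monoˡ-≤ (- x) p)

  from0≤y-x : ∀ {x y} → 0# ≤ y - x → x ≤ y
  from0≤y-x {x} {y} p = subst₂ _≤_ (+-identityˡ x)
    (trans (+-assoc y (- x) x) (trans (cong (y +_) (-‿inverseˡ x)) (+-identityʳ y)))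
    (+-monoˡ-≤ x p)

  *-monoˡ-≤ : ∀ {z x y} → 0# ≤ z → x ≤ y → z * x ≤ z * y
  *-monoˡ-≤ {z} {x} {y} 0≤z p = from0≤y-x (subst (0# ≤_)
    (trans (distribˡ z y (- x))
           (cong (z * y +_) (sym (-‿distribʳ-* z x))))
    (*-nonNeg 0≤z (0≤y-x p)))

  *-monoʳ-≤ : ∀ {z x y} → 0# ≤ z → x ≤ y → x * z ≤ y * z
  *-monoʳ-≤ {z} {x} {y} 0≤z p = subst₂ _≤_ (*-comm z x) (*-comm z y) (*-monoˡ-≤ 0≤z p)

  neg-≤ : ∀ {x} → x ≤ 0# → 0# ≤ - x
  neg-≤ {x} p = subst (0# ≤_) (+-identityˡ (- x)) (0≤y-x p)

  0≤1 : 0# ≤ 1#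
  0≤1 with total 0# 1#
  ... | inj₁ p = p
  ... | inj₂ p = subst (0# ≤_)
    (trans (sym (-‿distribʳ-* (- 1#) 1#))
      (trans (cong -_ (*-identityʳ (- 1#)))
        (-‿involutive 1#)))
    (*-nonNeg (neg-≤ p) (neg-≤ p))

  0≤x^n : ∀ {x} n → 0# ≤ x → 0# ≤ x ^ n
  0≤x^n zero    _ = 0≤1
  0≤x^n (suc n) p = *-nonNeg p (0≤x^n n p)

  ^-monoˡ-≤ : ∀ {x y} n → 0# ≤ x → x ≤ y → x ^ n ≤ y ^ n
  ^-monoˡ-≤ zero    _ _ = ≤-refl
  ^-monoˡ-≤ {x} {y} (suc n) p q = ≤-trans
    (*-monoˡ-≤ p (^-monoˡ-≤ n p q))
    (*-monoʳ-≤ (0≤x^n n (≤-trans p q)) q)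

  0≤fromℕ : ∀ n → 0# ≤ fromℕ n
  0≤fromℕ zero    = ≤-refl
  0≤fromℕ (suc n) = subst (_≤ fromℕ (suc n)) (+-identityˡ 0#) (+-mono-≤ 0≤1 (0≤fromℕ n))

  fromℕ-+ : ∀ m n → fromℕ (m ℕ.+ n) ≡ fromℕ m + fromℕ n
  fromℕ-+ = Mult.×-homo-+ 1#

  fromℕ-mono : ∀ {m n} → m ℕ.≤ n → fromℕ m ≤ fromℕ n
  fromℕ-mono {n = n} ℕ.z≤n = 0≤fromℕ n
  fromℕ-mono (ℕ.s≤s p) = +-monoʳ-≤ 1# (fromℕ-mono p)

  two* : ∀ x → fromℕ 2 * x ≡ x + x
  two* x = trans (distribʳ x 1# (1# + 0#))
    (cong₂ _+_ (*-identityˡ x)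
      (trans (distribʳ x 1# 0#)
        (trans (cong₂ _+_ (*-identityˡ x) (zeroˡ x)) (+-identityʳ x))))

  1≤2^n : ∀ n → 1# ≤ fromℕ 2 ^ n
  1≤2^n zero    = ≤-refl
  1≤2^n (suc n) = subst₂ _≤_ (+-identityˡ 1#) (sym (two* (fromℕ 2 ^ n)))
    (+-mono-≤ (≤-trans 0≤1 (1≤2^n n)) (1≤2^n n))

  n≤2^n : ∀ n → fromℕ n ≤ fromℕ 2 ^ n
  n≤2^n zero    = 0≤1
  n≤2^n (suc n) = subst (fromℕ (suc n) ≤_) (sym (two* (fromℕ 2 ^ n)))
    (+-mono-≤ (1≤2^n n) (n≤2^n n))

  2^-cancel-≤ : ∀ m n → fromℕ 2 ^ m ≤ fromℕ 2 ^ n → m ℕ.≤ n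
  2^-cancel-≤ m n p with m ℕ.≤? n
  ... | yes m≤n = m≤n
  ... | no m≰n = contradiction (≤-antisym 0≤1 1≤0) 0≢1
    where
    y = fromℕ 2 ^ n
    2^-mono : ∀ {k l} → k ℕ.≤ l → fromℕ 2 ^ k ≤ fromℕ 2 ^ l
    2^-mono {l = l} ℕ.z≤n = 1≤2^n l
    2^-mono (ℕ.s≤s q)     = *-monoˡ-≤ (0≤fromℕ 2) (2^-mono q)
    y+y≤y : y + y ≤ y
    y+y≤y = subst (_≤ y) (two* y) (≤-trans (2^-mono (ℕ.≰⇒> m≰n)) p)
    y≤0 : y ≤ 0#
    y≤0 = subst₂ _≤_ (+-cancel y y) (-‿inverseʳ y) (+-monoˡ-≤ (- y) y+y≤y)
    1≤0 : 1# ≤ 0#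
    1≤0 = ≤-trans (1≤2^n n) y≤0

  *-cancelʳ-≤ : ∀ {x y} k → x * fromℕ (suc k) ≤ y * fromℕ (suc k) → x ≤ y
  *-cancelʳ-≤ {x} {y} k p with total x y
  ... | inj₁ x≤y = x≤y
  ... | inj₂ y≤x = subst₂ _≤_ x-y+y≡x (+-identityˡ y)
                     (+-monoˡ-≤ y (≤-trans d≤dK dK≤0))
    where
    d = x - y
    K = fromℕ (suc k)
    d≤dK : d ≤ d * K
    d≤dK = subst (_≤ d * K) (*-identityʳ d)
      (*-monoˡ-≤ (0≤y-x y≤x)
        (subst (_≤ K) (+-identityʳ 1#) (+-monoʳ-≤ 1# (0≤fromℕ k))))
    dK≤0 : d * K ≤ 0#
    dK≤0 = subst₂ _≤_
      (trans (cong (x * K +_) (-‿distribˡ-* y K)) (sym (distribʳ K x (- y))))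
      (-‿inverseʳ (y * K))
      (+-monoˡ-≤ (- (y * K)) p)
    x-y+y≡x : d + y ≡ x
    x-y+y≡x = trans (+-assoc x (- y) y)
                (trans (cong (x +_) (-‿inverseˡ y)) (+-identityʳ x))

module Logarithm (R : Reals) where
  open Reals R
  open OrderedFieldLemmas orderedField
  open CommutativeRing commutativeRing using (*-identityʳ; +-identityʳ)
  open import Algebra.Properties.Semiring.Exp semiring using (^-homo-*; ^-assocʳ)
  import Algebra.Properties.Semiring.Mult semiring as Mult

  -- The rational numbers (m - m′) / (1 + n) not exceeding log₂ x.
  BelowLog₂ : ℝ → Pred ℝ 0ℓ
  BelowLog₂ x r =
    ∃ λ m → ∃ λ m′ → ∃ λ n →
      (r * fromℕ (suc n) ≡ fromℕ m - fromℕ m′) ×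
      (fromℕ 2 ^ m ≤ x ^ suc n * fromℕ 2 ^ m′)

  belowLog₂-nonempty : ∀ {x} → ¬ (x ≤ 0#) → ∃ (BelowLog₂ x)
  belowLog₂-nonempty {x} x≰0 with archimedean (x ⁻¹)
  ... | N , x⁻¹≤N = (0# - fromℕ N) , 0 , N , 0 ,
      trans (cong ((0# - fromℕ N) *_) (+-identityʳ 1#)) (*-identityʳ _) , bound
    where
    0≤x : 0# ≤ x
    0≤x with total 0# x
    ... | inj₁ p = p
    ... | inj₂ p = contradiction p x≰0
    bound : 1# ≤ x ^ 1 * fromℕ 2 ^ N
    bound = subst₂ _≤_ (*-inverseʳ (λ x≡0 → x≰0 (≤-reflexive x≡0)))
      (cong (_* fromℕ 2 ^ N) (sym (*-identityʳ x)))
      (*-monoˡ-≤ 0≤x (≤-trans x⁻¹≤N (n≤2^n N)))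

  belowLog₂-bounded : ∀ {x} → ¬ (x ≤ 0#) → ∃ (UpperBound (BelowLog₂ x))
  belowLog₂-bounded {x} x≰0 with archimedean x
  ... | N , x≤N = fromℕ N , bound
    where
    0≤x : 0# ≤ x
    0≤x with total 0# x
    ... | inj₁ p = p
    ... | inj₂ p = contradiction p x≰0
    bound : UpperBound (BelowLog₂ x) (fromℕ N)
    bound {r} (m , m′ , n , eq , le) = *-cancelʳ-≤ n
      (subst₂ _≤_ (sym eq) (Mult.×1-homo-* N (suc n))
        (subst (fromℕ m - fromℕ m′ ≤_)
          (trans (cong (_- fromℕ m′) (fromℕ-+ (N ℕ.* suc n) m′)) (+-cancel _ _))
          (+-monoˡ-≤ (- fromℕ m′) (fromℕ-mono m≤))))
      where
      m≤ : m ℕ.≤ N ℕ.* suc n ℕ.+ m′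
      m≤ = 2^-cancel-≤ m _ (≤-trans le
        (subst (x ^ suc n * fromℕ 2 ^ m′ ≤_)
          (trans (cong (_* fromℕ 2 ^ m′) (^-assocʳ (fromℕ 2) N (suc n)))
                 (sym (^-homo-* (fromℕ 2) (N ℕ.* suc n) m′)))
          (*-monoʳ-≤ (0≤x^n m′ (0≤fromℕ 2))
            (^-monoˡ-≤ (suc n) 0≤x (≤-trans x≤N (n≤2^n N))))))

  -- The logarithm to base 2, as the supremum of its rational lower bounds;
  -- the value for x ≤ 0 is a dummy.
  log₂ : Op₁ ℝ
  log₂ x with x ≤? 0#
  ... | yes _   = 0#
  ... | no  x≰0 = proj₁ (supremum (BelowLog₂ x) (belowLog₂-nonempty x≰0) (belowLog₂-bounded x≰0))

module LinearAlgebra (F : OrderedField) where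
  open OrderedField F

  infix  4 _≐_
  infixl 7 _·_ _·ᵥ_
  infix  9 _ᵀ

  Matrix : ℕ → Set
  Matrix n = Fin n → Fin n → ℝ

  _≐_ : ∀ {n} → Rel (Matrix n) 0ℓ
  A ≐ B = ∀ i j → A i j ≡ B i j

  diagonal : ∀ {n} → Vector ℝ n → Matrix n
  diagonal σ i j = if does (i Fin.≟ j) then σ i else 0#

  I : ∀ {n} → Matrix n
  I = diagonal (λ _ → 1#)

  _·_ : ∀ {n} → Op₂ (Matrix n)
  (A · B) i j = sum (λ k → A i k * B k j)

  _·ᵥ_ : ∀ {n} → Matrix n → Vector ℝ n → Vector ℝ n
  (A ·ᵥ x) i = sum (λ j → A i j * x j)

  _ᵀ : ∀ {n} → Op₁ (Matrix n)
  (A ᵀ) i j = A j i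

  Symmetric : ∀ {n} → Pred (Matrix n) 0ℓ
  Symmetric A = A ᵀ ≐ A

  Orthogonal : ∀ {n} → Pred (Matrix n) 0ℓ
  Orthogonal V = (V · V ᵀ ≐ I) × (V ᵀ · V ≐ I)

  Inverse : ∀ {n} → Rel (Matrix n) 0ℓ
  Inverse A B = (A · B ≐ I) × (B · A ≐ I)

  NonSingular : ∀ {n} → Pred (Matrix n) 0ℓ
  NonSingular A = ∃ (Inverse A)

  InRange : ∀ {n} → Matrix n → Pred (Vector ℝ n) 0ℓ
  InRange A b = ∃ λ x → ∀ i → (A ·ᵥ x) i ≡ b i

  reciprocal₀ : Op₁ ℝ
  reciprocal₀ x = if does (x ≟ 0#) then 0# else x ⁻¹

  -- InverseOrPseudoInverse A B holds when B is the matrix denoted A⁻¹: the inverse,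
  -- or the pseudo-inverse given by an orthogonal diagonalisation of a singular
  -- symmetric matrix.
  data InverseOrPseudoInverse {n} (A B : Matrix n) : Set where
    inverse       : Inverse A B → InverseOrPseudoInverse A B
    pseudoInverse : ¬ NonSingular A → Symmetric A →
                    ∀ V σ → Orthogonal V →
                    A ≐ V · diagonal σ · V ᵀ →
                    B ≐ V · diagonal (λ i → reciprocal₀ (σ i)) · V ᵀ →
                    InverseOrPseudoInverse A B

  -- The entries maximised over are non-negative, so 0# is a neutral start.
  maxAbs : ∀ {n} → Vector ℝ n → ℝ
  maxAbs = foldr (λ x m → ∣ x ∣ ⊔ m) 0#

  ‖_‖ᵥ : ∀ {n} → Vector ℝ n → ℝ
  ‖ x ‖ᵥ = maxAbs x

  ‖_‖ : ∀ {n} → Matrix n → ℝ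
  ‖ A ‖ = maxAbs (λ i → sum (λ j → ∣ A i j ∣))

  maxDiagonal : ∀ {n} → Matrix n → ℝ
  maxDiagonal A = maxAbs (λ i → A i i)

  κ : ∀ {n} (A A⁻¹ : Matrix n) → ℝ
  κ A A⁻¹ = ‖ A ‖ * ‖ A⁻¹ ‖

  offDiagonalSum : ∀ {n} → Matrix n → Fin n → ℝ
  offDiagonalSum A i = sum (λ j → if does (i Fin.≟ j) then 0# else ∣ A i j ∣)

  DiagonallyDominant : ∀ {n} → Pred (Matrix n) 0ℓ
  DiagonallyDominant A = ∀ i → offDiagonalSum A i ≤ ∣ A i i ∣

  NonZeroDiagonalOfOneSign : ∀ {n} → Pred (Matrix n) 0ℓ
  NonZeroDiagonalOfOneSign A = (∀ i → 0# < A i i) ⊎ (∀ i → A i i < 0#)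

module Queries (F : OrderedField) where
  open OrderedField F
  open LinearAlgebra F

  Edge : ∀ {n} → Matrix n → Rel (Fin n) 0ℓ
  Edge S u v = (u ≢ v) × (S u v ≢ 0#)

  edge? : ∀ {n} (S : Matrix n) u → Decidable (Edge S u)
  edge? S u v = ¬? (u Fin.≟ v) ×-dec ¬? (S u v ≟ 0#)

  outNeighbours : ∀ {n} → Matrix n → Fin n → List (Fin n)
  outNeighbours S u = filter (edge? S u) (allFin _)

  Δᵒᵘᵗ : ∀ {n} → Matrix n → Fin n → ℕ
  Δᵒᵘᵗ S u = length (outNeighbours S u)

  dᵒᵘᵗ : ∀ {n} → Matrix n → Fin n → ℝ
  dᵒᵘᵗ = offDiagonalSum

  -- An instance (S, b) together with the fixed but arbitrary ordering of the
  -- out-neighbours of each vertex.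
  record Oracle (n : ℕ) : Set where
    field
      S        : Matrix n
      b        : Vector ℝ n
      ordering : Fin n → List (Fin n)
      isOrdering : ∀ u → ordering u ↭ outNeighbours S u

  -- Randomised query algorithms, as decision trees whose branches may depend
  -- arbitrarily on the real numbers seen so far.  An algorithm is not told n:
  -- it refers to vertices by the numbers 0, 1, 2, …, which it learns from its
  -- input and from the answers of the oracle.
  data Algorithm : Set where
    return    : (z : ℝ) → Algorithm
    -- the algorithm's own randomness: i is drawn with probability p i
    sample    : (k : ℕ) (p : Vector ℝ k) → (∀ i → 0# ≤ p i) → sum p ≡ 1# →
                (Fin k → Algorithm) → Algorithm
    -- vertex u: the answer is Δᵒᵘᵗ u, dᵒᵘᵗ u, S u u, b u
    vertex    : (u : ℕ) → (ℕ → ℝ → ℝ → ℝ → Algorithm) → Algorithm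
    -- neighbour u i: the answer is the i-th out-neighbour of u, from i = 0
    neighbour : (u i : ℕ) → (ℕ → Algorithm) → Algorithm
    -- walk u: the answer is just (v , S u v), or nothing in place of ⊥
    walk      : (u : ℕ) → (Maybe (ℕ × ℝ) → Algorithm) → Algorithm

  toVertex : (n u : ℕ) → Maybe (Fin n)
  toVertex n u with u ℕ.<? n
  ... | yes u<n = just (fromℕ< u<n)
  ... | no  _   = nothing

  module Run {n} (O : Oracle n) where
    open Oracle O

    neighbourAt : ℕ → ℕ → Maybe (Fin n)
    neighbourAt u i = maybe (λ u → head (drop i (ordering u))) nothing (toVertex n u)

    walkProbability : Fin n → Fin n → ℝ
    walkProbability u v = if does (edge? S u v) then ∣ S u v ∣ / dᵒᵘᵗ S u else 0#

    -- The probability that the algorithm returns a value satisfying P.  A run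
    -- that makes an ill-formed query (a vertex outside [n], or a neighbour index
    -- outside [Δᵒᵘᵗ u]) is aborted and counts as a failure.
    probability : ∀ {P : Pred ℝ 0ℓ} → Decidable P → Algorithm → ℝ
    probability P? (return z) = if does (P? z) then 1# else 0#
    probability P? (sample k p _ _ next) = sum (λ i → p i * probability P? (next i))
    probability P? (vertex u next) with toVertex n u
    ... | nothing = 0#
    ... | just u  = probability P? (next (Δᵒᵘᵗ S u) (dᵒᵘᵗ S u) (S u u) (b u))
    probability P? (neighbour u i next) with neighbourAt u i
    ... | nothing = 0#
    ... | just v  = probability P? (next (toℕ v))
    probability P? (walk u next) with toVertex n u
    ... | nothing = 0#
    ... | just u with outNeighbours S u
    ...   | []    = probability P? (next nothing)
    ...   | _ ∷ _ = sum (λ v → walkProbability u v *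
                               probability P? (next (just (toℕ v , S u v))))

    -- The number of queries in the worst case over all random outcomes.
    queries : Algorithm → ℕ
    queries (return _) = 0
    queries (sample k _ _ _ next) = max 0 (map (λ i → queries (next i)) (allFin k))
    queries (vertex u next) with toVertex n u
    ... | nothing = 1
    ... | just u  = suc (queries (next (Δᵒᵘᵗ S u) (dᵒᵘᵗ S u) (S u u) (b u)))
    queries (neighbour u i next) with neighbourAt u i
    ... | nothing = 1
    ... | just v  = suc (queries (next (toℕ v)))
    queries (walk u next) with toVertex n u
    ... | nothing = 1
    ... | just u with outNeighbours S u
    ...   | []     = suc (queries (next nothing))
    ...   | v ∷ vs = suc (max 0 (map (λ v → queries (next (just (toℕ v , S u v)))) (v ∷ vs)))

  Accurate : ∀ {n} → ℝ → Vector ℝ n → Fin n → Pred ℝ 0ℓ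
  Accurate ε z* u z =
    (∣ z - z* u ∣ < ε * ‖ z* ‖ᵥ) ⊎
    ((∀ i → z* i ≡ 0#) × (∣ z - z* u ∣ ≤ ε * ‖ z* ‖ᵥ))

  accurate? : ∀ {n} ε (z* : Vector ℝ n) u → Decidable (Accurate ε z* u)
  accurate? ε z* u z =
    (∣ z - z* u ∣ <? ε * ‖ z* ‖ᵥ) ⊎-dec
    (Fin.all? (λ i → z* i ≟ 0#) ×-dec (∣ z - z* u ∣ ≤? ε * ‖ z* ‖ᵥ))

{-# OPTIONS --safe #-}
-- Moving every diagonal entry of S away from 0 by δ = Θ(ε S_max / κ) makes the
-- Jacobi iteration contract by the factor 1 - Θ(ε / κ), and a random walk of the
-- oracle gives an unbiased estimate of its T-th iterate w, bounded by
-- O(κ ‖z*‖ / ε); the mean of O(κ² / ε⁴) walks is concentrated around w u.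
--
-- For the bias, e = w - z* satisfies S e = - (δ s w + y), where s is the diagonal
-- matrix of the signs of the diagonal of S, and y is an exponentially small
-- residual.  So S⁻¹ S e has norm at most ‖S⁻¹‖ (2 δ ‖z*‖ + ‖y‖).  The remaining part
-- e - S⁻¹ S e = w - S⁻¹ S w vanishes if S is non-singular; otherwise s = ± 1, and as
-- δ s w + y is in the range of S, it is bounded by (1 + κ) ‖y‖ / δ.
module Submission where

open import Defs
open import Level using (0ℓ)
open import Algebra.Bundles using (CommutativeRing)
open import Data.Bool.Base using (if_then_else_; true; false; _∧_; not)
open import Data.Fin.Base using (Fin; toℕ; zero; suc)
import Data.Fin.Properties as Fin
open import Data.Integer.Base as ℤ using (ℤ; -[1+_]; _⊖_) renaming (+_ to pos)
import Data.Integer.Properties as ℤ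
open import Data.List.Base using ([]; _∷_; allFin)
open import Data.List.Extrema.Nat using (max≤v⁺)
open import Data.List.Membership.Propositional using (_∈_)
open import Data.List.Membership.Propositional.Properties using (∈-filter⁺; ∈-filter⁻; ∈-allFin)
import Data.List.Relation.Unary.All as All
import Data.List.Relation.Unary.All.Properties as All
open import Data.List.Relation.Unary.Any using (here)
open import Data.Maybe.Base using (Maybe; just; nothing; map; maybe′)
open import Data.Nat.Base as ℕ using (ℕ; zero; suc)
import Data.Nat.Properties as ℕ
open import Data.Product.Base using (∃; Σ-syntax; _×_; _,_; proj₁; proj₂)
open import Data.Sum.Base as Sum using (_⊎_; inj₁; inj₂)
open import Data.Vec.Functional using (Vector)
open import Function.Base using (_∘_)
open import Relation.Binary.PropositionalEquality
  using (_≡_; _≢_; refl; sym; trans; cong; cong₂; subst; subst₂; module ≡-Reasoning)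
open import Relation.Nullary using (¬_; yes; no; does; contradiction)
open import Relation.Nullary.Decidable using (dec-true; dec-false; dec⇒maybe)
open import Relation.Unary using (Pred; Decidable)

-- Dominance is not strict, so the unshifted Jacobi iteration need not contract and an unshifted
-- walk need not lose weight. The shift buys both, but `κ` speaks of `S⁻¹` and not of the inverse of
-- the shifted matrix. That second inverse is never considered: the iterates are compared with `z*`
-- itself. In the error equation of one step the shift contributes at most `δ ‖z*‖`, which is
-- exactly what enlarging the pivot by `δ` absorbs. Hence every iterate stays within `‖z*‖` of `z*`,
-- with no factor of `κ`, and this is why the bias is proportional to `δ ‖z*‖`.
--
-- On the side of probability, the model provides only the chance that a run ends in a given set;
-- there is no expectation or variance to compute with. Both are encoded as transformations of lower
-- bounds. If the continuation succeeds with probability at least an affine function of the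
-- estimate, the whole run succeeds with probability at least the value of that function at the
-- mean. A quadratic lower bound for a sum is reduced to affine ones by means of the bound on a
-- single walk.

-- The ring solver with integer coefficients, where a literal denotes fromℕ of it
-- (but 1 denotes 1#, rather than the 1# + 0# that fromℕ 1 computes to).
module IntegerSolver (F : OrderedField) where
  open OrderedField F
  open OrderedFieldLemmas F using (+-cancel; fromℕ-+)
  open CommutativeRing commutativeRing
    using (+-comm; +-assoc; +-identityˡ; +-identityʳ; ring; +-abelianGroup)
  open import Algebra.Properties.Ring ring using (-‿distribˡ-*; -‿distribʳ-*; -‿involutive; -0#≈0#)
  open import Algebra.Properties.AbelianGroup +-abelianGroup using (⁻¹-∙-comm)
  import Algebra.Properties.Semiring.Mult semiring as Mult
  open import Algebra.Solver.Ring.AlmostCommutativeRing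
  open ≡-Reasoning

  ⟦_⟧ℕ : ℕ → ℝ
  ⟦ 0 ⟧ℕ           = 0#
  ⟦ 1 ⟧ℕ           = 1#
  ⟦ suc (suc n) ⟧ℕ = fromℕ (suc (suc n))

  ⟦⟧ℕ≡fromℕ : ∀ n → ⟦ n ⟧ℕ ≡ fromℕ n
  ⟦⟧ℕ≡fromℕ 0             = refl
  ⟦⟧ℕ≡fromℕ 1             = sym (+-identityʳ 1#)
  ⟦⟧ℕ≡fromℕ (suc (suc n)) = refl

  ⟦_⟧ℤ : ℤ → ℝ
  ⟦ pos n ⟧ℤ      = ⟦ n ⟧ℕ
  ⟦ -[1+ n ] ⟧ℤ = - ⟦ suc n ⟧ℕ

  private
    -‿+ : ∀ x y → - (x + y) ≡ - x + - y
    -‿+ x y = sym (⁻¹-∙-comm x y)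

  -- The right-hand side uses `fromℕ` because `fromℕ (suc m)` unfolds uniformly to `1# + fromℕ m`,
  -- whereas `⟦_⟧ℕ` makes an exception at 1; the induction cancels the common `1#`.
  ⊖-homo : ∀ m n → ⟦ m ⊖ n ⟧ℤ ≡ fromℕ m - fromℕ n
  ⊖-homo m zero = begin
    ⟦ m ⟧ℕ        ≡⟨ ⟦⟧ℕ≡fromℕ m ⟩
    fromℕ m       ≡⟨ +-identityʳ _ ⟨
    fromℕ m + 0#  ≡⟨ cong (fromℕ m +_) -0#≈0# ⟨
    fromℕ m - 0#  ∎
  ⊖-homo zero (suc n) = trans (cong -_ (⟦⟧ℕ≡fromℕ (suc n))) (sym (+-identityˡ _))
  ⊖-homo (suc m) (suc n) = begin
    ⟦ suc m ⊖ suc n ⟧ℤ                 ≡⟨ cong ⟦_⟧ℤ (ℤ.[1+m]⊖[1+n]≡m⊖n m n) ⟩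
    ⟦ m ⊖ n ⟧ℤ                         ≡⟨ ⊖-homo m n ⟩
    fromℕ m - fromℕ n                  ≡⟨ cong (_- fromℕ n) (trans (sym (+-cancel _ 1#)) (cong (_- 1#) (+-comm _ _))) ⟩
    (1# + fromℕ m) - 1# - fromℕ n      ≡⟨ +-assoc _ _ _ ⟩
    fromℕ (suc m) + (- 1# - fromℕ n)   ≡⟨ cong (fromℕ (suc m) +_) (-‿+ _ _) ⟨
    fromℕ (suc m) - fromℕ (suc n)      ∎

  neg-homo : ∀ i → ⟦ ℤ.- i ⟧ℤ ≡ - ⟦ i ⟧ℤ
  neg-homo (pos zero)       = sym -0#≈0#
  neg-homo (pos (suc n))   = refl
  neg-homo -[1+ n ]    = sym (-‿involutive _)

  +-homo : ∀ i j → ⟦ i ℤ.+ j ⟧ℤ ≡ ⟦ i ⟧ℤ + ⟦ j ⟧ℤ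
  +-homo (pos m) (pos n) = trans (⟦⟧ℕ≡fromℕ (m ℕ.+ n)) (trans (fromℕ-+ m n)
    (sym (cong₂ _+_ (⟦⟧ℕ≡fromℕ m) (⟦⟧ℕ≡fromℕ n))))
  +-homo (pos m) -[1+ n ] = trans (⊖-homo m (suc n))
    (sym (cong₂ _-_ (⟦⟧ℕ≡fromℕ m) (⟦⟧ℕ≡fromℕ (suc n))))
  +-homo -[1+ m ] (pos n) = trans (⊖-homo n (suc m)) (trans (+-comm _ _)
    (sym (cong₂ (λ x y → - x + y) (⟦⟧ℕ≡fromℕ (suc m)) (⟦⟧ℕ≡fromℕ n))))
  +-homo -[1+ m ] -[1+ n ] = begin
    - fromℕ (suc (suc (m ℕ.+ n)))         ≡⟨ cong (-_ ∘ fromℕ ∘ suc) (ℕ.+-suc m n) ⟨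
    - fromℕ (suc m ℕ.+ suc n)             ≡⟨ cong -_ (fromℕ-+ (suc m) (suc n)) ⟩
    - (fromℕ (suc m) + fromℕ (suc n))     ≡⟨ -‿+ _ _ ⟩
    - fromℕ (suc m) - fromℕ (suc n)       ≡⟨ cong₂ (λ x y → - x - y) (⟦⟧ℕ≡fromℕ (suc m)) (⟦⟧ℕ≡fromℕ (suc n)) ⟨
    - ⟦ suc m ⟧ℕ - ⟦ suc n ⟧ℕ             ∎

  *ℕ-homo : ∀ m n → ⟦ m ℕ.* n ⟧ℕ ≡ ⟦ m ⟧ℕ * ⟦ n ⟧ℕ
  *ℕ-homo m n = trans (⟦⟧ℕ≡fromℕ (m ℕ.* n)) (trans (Mult.×1-homo-* m n)
    (sym (cong₂ _*_ (⟦⟧ℕ≡fromℕ m) (⟦⟧ℕ≡fromℕ n))))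

  *-homo : ∀ i j → ⟦ i ℤ.* j ⟧ℤ ≡ ⟦ i ⟧ℤ * ⟦ j ⟧ℤ
  *-homo (pos m) (pos n) = trans (cong ⟦_⟧ℤ (sym (ℤ.pos-* m n))) (*ℕ-homo m n)
  *-homo (pos m) -[1+ n ] = begin
    ⟦ pos m ℤ.* -[1+ n ] ⟧ℤ        ≡⟨ cong ⟦_⟧ℤ (sym (ℤ.neg-distribʳ-* (pos m) (pos (suc n)))) ⟩
    ⟦ ℤ.- (pos m ℤ.* pos (suc n)) ⟧ℤ   ≡⟨ neg-homo (pos m ℤ.* pos (suc n)) ⟩
    - ⟦ pos m ℤ.* pos (suc n) ⟧ℤ       ≡⟨ cong -_ (*-homo (pos m) (pos (suc n))) ⟩
    - (⟦ m ⟧ℕ * ⟦ suc n ⟧ℕ)      ≡⟨ -‿distribʳ-* _ _ ⟩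
    ⟦ m ⟧ℕ * - ⟦ suc n ⟧ℕ        ∎
  *-homo -[1+ m ] (pos n) = begin
    ⟦ -[1+ m ] ℤ.* pos n ⟧ℤ        ≡⟨ cong ⟦_⟧ℤ (sym (ℤ.neg-distribˡ-* (pos (suc m)) (pos n))) ⟩
    ⟦ ℤ.- (pos (suc m) ℤ.* pos n) ⟧ℤ   ≡⟨ neg-homo (pos (suc m) ℤ.* pos n) ⟩
    - ⟦ pos (suc m) ℤ.* pos n ⟧ℤ       ≡⟨ cong -_ (*-homo (pos (suc m)) (pos n)) ⟩
    - (⟦ suc m ⟧ℕ * ⟦ n ⟧ℕ)      ≡⟨ -‿distribˡ-* _ _ ⟩
    - ⟦ suc m ⟧ℕ * ⟦ n ⟧ℕ        ∎
  *-homo -[1+ m ] -[1+ n ] = begin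
    ⟦ pos (suc m ℕ.* suc n) ⟧ℤ     ≡⟨ *ℕ-homo (suc m) (suc n) ⟩
    ⟦ suc m ⟧ℕ * ⟦ suc n ⟧ℕ      ≡⟨ -‿involutive _ ⟨
    - - (⟦ suc m ⟧ℕ * ⟦ suc n ⟧ℕ) ≡⟨ cong -_ (-‿distribˡ-* _ _) ⟩
    - (- ⟦ suc m ⟧ℕ * ⟦ suc n ⟧ℕ) ≡⟨ -‿distribʳ-* _ _ ⟩
    - ⟦ suc m ⟧ℕ * - ⟦ suc n ⟧ℕ  ∎

  morphism : ℤ.+-*-rawRing -Raw-AlmostCommutative⟶ fromCommutativeRing commutativeRing
  morphism = record
    { ⟦_⟧    = ⟦_⟧ℤ
    ; +-homo = +-homo
    ; *-homo = *-homo
    ; -‿homo = neg-homo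
    ; 0-homo = refl
    ; 1-homo = refl
    }

  open import Algebra.Solver.Ring ℤ.+-*-rawRing (fromCommutativeRing commutativeRing) morphism
    (λ i j → map (cong ⟦_⟧ℤ) (dec⇒maybe (i ℤ.≟ j))) public
    using (solve; _:=_; _:+_; _:*_; _:-_; :-_; _:^_; con; Polynomial)

  lit : ∀ {n} → ℕ → Polynomial n
  lit n = con (pos n)

-- Order, absolute value and sign in an ordered field

module FieldProperties (F : OrderedField) where
  open OrderedField F
  open OrderedFieldLemmas F public
  open IntegerSolver F
  open import Algebra.Construct.NaturalChoice.Max totalOrder using (maxOperator)
  open import Algebra.Construct.NaturalChoice.MaxOp maxOperator using (⊔-lub; x≤x⊔y; x≤y⊔x)
  import Algebra.Properties.Semiring.Mult semiring as Mult
  open ≡-Reasoning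

  -- Turns an inequality into a certificate: the gap is written as an expression that is visibly
  -- non-negative, and the ring solver checks the identity. Most numerical estimates below have this
  -- form.
  ≤-by : ∀ {x y t} → 0# ≤ t → y - x ≡ t → x ≤ y
  ≤-by p eq = from0≤y-x (subst (0# ≤_) (sym eq) p)

  0≤+ : ∀ {x y} → 0# ≤ x → 0# ≤ y → 0# ≤ x + y
  0≤+ p q = ≤-by (*-nonNeg 0≤1 (≤-trans p (≤-by q (solve 2 (λ x y → (x :+ y) :- x := y) refl _ _))))
    (solve 1 (λ x → x :- lit 0 := lit 1 :* x) refl _)

  0≤x² : ∀ x → 0# ≤ x * x
  0≤x² x with total 0# x
  ... | inj₁ p = *-nonNeg p p
  ... | inj₂ p = subst (0# ≤_) (solve 1 (λ x → :- x :* :- x := x :* x) refl x)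
                   (*-nonNeg (neg-≤ p) (neg-≤ p))

  *-mono-≤ : ∀ {x y u v} → 0# ≤ x → 0# ≤ v → x ≤ y → u ≤ v → x * u ≤ y * v
  *-mono-≤ 0≤x 0≤v p q = ≤-trans (*-monoˡ-≤ 0≤x q) (*-monoʳ-≤ 0≤v p)

  -x≤0 : ∀ {x} → 0# ≤ x → - x ≤ 0#
  -x≤0 p = ≤-by p (solve 1 (λ x → lit 0 :- (:- x) := x) refl _)

  ≰⇒≥ : ∀ {x y} → ¬ x ≤ y → y ≤ x
  ≰⇒≥ {x} {y} p with total x y
  ... | inj₁ q = contradiction q p
  ... | inj₂ q = q

  ≰⇒< : ∀ {x y} → ¬ x ≤ y → y < x
  ≰⇒< p = ≰⇒≥ p , λ { refl → p ≤-refl }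

  ≮⇒≥ : ∀ {x y} → ¬ x < y → y ≤ x
  ≮⇒≥ {x} {y} p with y ≤? x
  ... | yes q = q
  ... | no  q = contradiction (≰⇒< q) p

  <⇒≱ : ∀ {x y} → x < y → ¬ y ≤ x
  <⇒≱ (p , q) r = q (≤-antisym p r)

  <-≤-trans : ∀ {x y z} → x < y → y ≤ z → x < z
  <-≤-trans p q = ≰⇒< (λ r → <⇒≱ p (≤-trans q r))

  ≤-<-trans : ∀ {x y z} → x ≤ y → y < z → x < z
  ≤-<-trans p q = ≰⇒< (λ r → <⇒≱ q (≤-trans r p))

  0<⇒≢0 : ∀ {x} → 0# < x → x ≢ 0#
  0<⇒≢0 p = proj₂ p ∘ sym

  0<1 : 0# < 1#
  0<1 = 0≤1 , 0≢1

  *-inverseˡ : ∀ {x} → x ≢ 0# → x ⁻¹ * x ≡ 1#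
  *-inverseˡ p = trans (solve 2 (λ x y → x :* y := y :* x) refl _ _) (*-inverseʳ p)

  *-cancelˡ-≡0 : ∀ {x y} → x ≢ 0# → x * y ≡ 0# → y ≡ 0#
  *-cancelˡ-≡0 {x} {y} x≢0 eq = begin
    y                ≡⟨ solve 1 (λ y → y := lit 1 :* y) refl y ⟩
    1# * y           ≡⟨ cong (_* y) (*-inverseˡ x≢0) ⟨
    x ⁻¹ * x * y     ≡⟨ solve 3 (λ a b c → a :* b :* c := a :* (b :* c)) refl _ _ _ ⟩
    x ⁻¹ * (x * y)   ≡⟨ cong (x ⁻¹ *_) eq ⟩
    x ⁻¹ * 0#        ≡⟨ solve 1 (λ y → y :* lit 0 := lit 0) refl _ ⟩
    0#               ∎

  0<* : ∀ {x y} → 0# < x → 0# < y → 0# < x * y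
  0<* p q = *-nonNeg (proj₁ p) (proj₁ q) , λ eq → 0<⇒≢0 q (*-cancelˡ-≡0 (0<⇒≢0 p) (sym eq))

  0<^ : ∀ {x} n → 0# < x → 0# < x ^ n
  0<^ zero    p = 0<1
  0<^ (suc n) p = 0<* p (0<^ n p)

  0<⁻¹ : ∀ {x} → 0# < x → 0# < x ⁻¹
  0<⁻¹ {x} p = ≰⇒< λ q → <⇒≱ 0<1 (subst₂ _≤_ (*-inverseʳ (0<⇒≢0 p))
    (solve 1 (λ x → x :* lit 0 := lit 0) refl x) (*-monoˡ-≤ (proj₁ p) q))

  *-cancelˡ-≤ : ∀ {z x y} → 0# < z → z * x ≤ z * y → x ≤ y
  *-cancelˡ-≤ {z} {x} {y} 0<z p = subst₂ _≤_ (lemma x) (lemma y) (*-monoˡ-≤ (proj₁ (0<⁻¹ 0<z)) p)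
    where
    lemma : ∀ x → z ⁻¹ * (z * x) ≡ x
    lemma x = trans (solve 3 (λ a b c → a :* (b :* c) := (a :* b) :* c) refl _ _ _)
      (trans (cong (_* x) (*-inverseˡ (0<⇒≢0 0<z))) (solve 1 (λ x → lit 1 :* x := x) refl x))

  /-*-cancel : ∀ x {y} → y ≢ 0# → x / y * y ≡ x
  /-*-cancel x y≢0 = trans (solve 3 (λ a b c → a :* b :* c := a :* (b :* c)) refl _ _ _)
    (trans (cong (x *_) (*-inverseˡ y≢0)) (solve 1 (λ x → x :* lit 1 := x) refl x))

  0<fromℕ : ∀ n → 0# < fromℕ (suc n)
  0<fromℕ n = <-≤-trans 0<1 (≤-by (0≤fromℕ n) (solve 1 (λ x → (lit 1 :+ x) :- lit 1 := x) refl _))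

  fromℕ-* : ∀ m n → fromℕ (m ℕ.* n) ≡ fromℕ m * fromℕ n
  fromℕ-* = Mult.×1-homo-*

  x≤∣x∣ : ∀ x → x ≤ ∣ x ∣
  x≤∣x∣ x = x≤x⊔y x (- x)

  -x≤∣x∣ : ∀ x → - x ≤ ∣ x ∣
  -x≤∣x∣ x = x≤y⊔x x (- x)

  ∣x∣≤ : ∀ {x a} → x ≤ a → - x ≤ a → ∣ x ∣ ≤ a
  ∣x∣≤ = ⊔-lub

  0≤∣x∣ : ∀ x → 0# ≤ ∣ x ∣
  0≤∣x∣ x with total 0# x
  ... | inj₁ p = ≤-trans p (x≤∣x∣ x)
  ... | inj₂ p = ≤-trans (neg-≤ p) (-x≤∣x∣ x)

  0≤x⇒∣x∣≡x : ∀ {x} → 0# ≤ x → ∣ x ∣ ≡ x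
  0≤x⇒∣x∣≡x p = ≤-antisym (∣x∣≤ ≤-refl (≤-trans (-x≤0 p) p)) (x≤∣x∣ _)

  x≤0⇒∣x∣≡-x : ∀ {x} → x ≤ 0# → ∣ x ∣ ≡ - x
  x≤0⇒∣x∣≡-x p = ≤-antisym (∣x∣≤ (≤-trans p (neg-≤ p)) ≤-refl) (-x≤∣x∣ _)

  ∣-x∣≡∣x∣ : ∀ x → ∣ - x ∣ ≡ ∣ x ∣
  ∣-x∣≡∣x∣ x = ≤-antisym
    (∣x∣≤ (-x≤∣x∣ x) (subst (_≤ ∣ x ∣) (sym neg-neg) (x≤∣x∣ x)))
    (∣x∣≤ (subst (_≤ ∣ - x ∣) neg-neg (-x≤∣x∣ (- x))) (x≤∣x∣ (- x)))
    where
    neg-neg : - - x ≡ x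
    neg-neg = solve 1 (λ x → :- (:- x) := x) refl x

  ∣x+y∣≤∣x∣+∣y∣ : ∀ x y → ∣ x + y ∣ ≤ ∣ x ∣ + ∣ y ∣
  ∣x+y∣≤∣x∣+∣y∣ x y = ∣x∣≤ (+-mono-≤ (x≤∣x∣ x) (x≤∣x∣ y))
    (subst (_≤ ∣ x ∣ + ∣ y ∣) (solve 2 (λ x y → :- x :+ :- y := :- (x :+ y)) refl x y)
      (+-mono-≤ (-x≤∣x∣ x) (-x≤∣x∣ y)))

  ∣x-y∣≤∣x∣+∣y∣ : ∀ x y → ∣ x - y ∣ ≤ ∣ x ∣ + ∣ y ∣
  ∣x-y∣≤∣x∣+∣y∣ x y = subst (∣ x - y ∣ ≤_) (cong (∣ x ∣ +_) (∣-x∣≡∣x∣ y)) (∣x+y∣≤∣x∣+∣y∣ x (- y))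

  -- The sign of 0 is taken to be 1, so that the square of a sign is always 1, multiplication by a
  -- sign preserves absolute values, and a zero diagonal entry is also moved away from 0.
  sgn : ℝ → ℝ
  sgn x = if does (0# ≤? x) then 1# else - 1#

  ∣∣-as-sgn : ∀ x → ∣ x ∣ ≡ sgn x * x
  ∣∣-as-sgn x with 0# ≤? x
  ... | yes p = trans (0≤x⇒∣x∣≡x p) (solve 1 (λ x → x := lit 1 :* x) refl x)
  ... | no  p = trans (x≤0⇒∣x∣≡-x (≰⇒≥ p)) (solve 1 (λ x → :- x := :- (lit 1) :* x) refl x)

  sgn² : ∀ x → sgn x * sgn x ≡ 1#
  sgn² x with 0# ≤? x
  ... | yes _ = solve 0 (lit 1 :* lit 1 := lit 1) refl
  ... | no  _ = solve 0 (:- (lit 1) :* :- (lit 1) := lit 1) refl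

  x≡sgn*∣x∣ : ∀ x → x ≡ sgn x * ∣ x ∣
  x≡sgn*∣x∣ x = begin
    x                     ≡⟨ solve 1 (λ x → x := lit 1 :* x) refl x ⟩
    1# * x                ≡⟨ cong (_* x) (sgn² x) ⟨
    sgn x * sgn x * x     ≡⟨ solve 2 (λ s x → s :* s :* x := s :* (s :* x)) refl (sgn x) x ⟩
    sgn x * (sgn x * x)   ≡⟨ cong (sgn x *_) (∣∣-as-sgn x) ⟨
    sgn x * ∣ x ∣         ∎

  ∣sgn*y∣≡∣y∣ : ∀ x y → ∣ sgn x * y ∣ ≡ ∣ y ∣
  ∣sgn*y∣≡∣y∣ x y with 0# ≤? x
  ... | yes _ = cong ∣_∣ (solve 1 (λ x → lit 1 :* x := x) refl y)
  ... | no  _ = trans (cong ∣_∣ (solve 1 (λ x → :- (lit 1) :* x := :- x) refl y)) (∣-x∣≡∣x∣ y)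

  ∣x*y∣≡∣x∣*∣y∣ : ∀ x y → ∣ x * y ∣ ≡ ∣ x ∣ * ∣ y ∣
  ∣x*y∣≡∣x∣*∣y∣ x y = begin
    ∣ x * y ∣                               ≡⟨ cong ∣_∣ (cong₂ _*_ (x≡sgn*∣x∣ x) (x≡sgn*∣x∣ y)) ⟩
    ∣ sgn x * ∣ x ∣ * (sgn y * ∣ y ∣) ∣     ≡⟨ cong ∣_∣ (solve 4 (λ a b c d → a :* b :* (c :* d) := a :* (c :* (b :* d))) refl (sgn x) (∣ x ∣) (sgn y) (∣ y ∣)) ⟩
    ∣ sgn x * (sgn y * (∣ x ∣ * ∣ y ∣)) ∣   ≡⟨ ∣sgn*y∣≡∣y∣ x _ ⟩
    ∣ sgn y * (∣ x ∣ * ∣ y ∣) ∣             ≡⟨ ∣sgn*y∣≡∣y∣ y _ ⟩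
    ∣ ∣ x ∣ * ∣ y ∣ ∣                       ≡⟨ 0≤x⇒∣x∣≡x (*-nonNeg (0≤∣x∣ x) (0≤∣x∣ y)) ⟩
    ∣ x ∣ * ∣ y ∣                           ∎

  ∣x∣≤0⇒x≡0 : ∀ {x} → ∣ x ∣ ≤ 0# → x ≡ 0#
  ∣x∣≤0⇒x≡0 {x} p = ≤-antisym (≤-trans (x≤∣x∣ x) p)
    (≤-by (neg-≤ (≤-trans (-x≤∣x∣ x) p)) (solve 1 (λ x → x :- lit 0 := :- (:- x)) refl x))

  ∣x∣²≡x² : ∀ x → ∣ x ∣ * ∣ x ∣ ≡ x * x
  ∣x∣²≡x² x = trans (sym (∣x*y∣≡∣x∣*∣y∣ x x)) (0≤x⇒∣x∣≡x (0≤x² x))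

  x²≤y² : ∀ {x y} → ∣ x ∣ ≤ y → x * x ≤ y * y
  x²≤y² {x} {y} p = subst (_≤ y * y) (∣x∣²≡x² x)
    (*-mono-≤ (0≤∣x∣ x) (≤-trans (0≤∣x∣ x) p) p p)

-- Finite sums, norms and the pseudo-inverse

module LinearAlgebraProperties (F : OrderedField) where
  open OrderedField F
  open LinearAlgebra F
  open FieldProperties F
  open IntegerSolver F
  open import Algebra.Properties.Semiring.Sum semiring public
    using (sum-cong-≗; ∑-distrib-+; ∑-comm; *-distribˡ-sum; *-distribʳ-sum; sum-replicate-zero)
  open import Algebra.Construct.NaturalChoice.Max totalOrder using (maxOperator)
  open import Algebra.Construct.NaturalChoice.MaxOp maxOperator using (⊔-lub; x≤x⊔y; x≤y⊔x)
  open ≡-Reasoning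

  private variable
    n : ℕ

  sum-mono-≤ : {f g : Vector ℝ n} → (∀ i → f i ≤ g i) → sum f ≤ sum g
  sum-mono-≤ {zero}  p = ≤-refl
  sum-mono-≤ {suc n} p = +-mono-≤ (p zero) (sum-mono-≤ (p ∘ suc))

  sum-zero : {f : Vector ℝ n} → (∀ i → f i ≡ 0#) → sum f ≡ 0#
  sum-zero {n} p = trans (sum-cong-≗ p) (sum-replicate-zero n)

  0≤sum : {f : Vector ℝ n} → (∀ i → 0# ≤ f i) → 0# ≤ sum f
  0≤sum {n} {f} p = subst (_≤ sum f) (sum-replicate-zero n) (sum-mono-≤ p)

  ∣sum∣≤sum∣∣ : (f : Vector ℝ n) → ∣ sum f ∣ ≤ sum (∣_∣ ∘ f)
  ∣sum∣≤sum∣∣ {zero}  f = ≤-reflexive (0≤x⇒∣x∣≡x ≤-refl)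
  ∣sum∣≤sum∣∣ {suc n} f = ≤-trans (∣x+y∣≤∣x∣+∣y∣ _ _) (+-monoʳ-≤ _ (∣sum∣≤sum∣∣ (f ∘ suc)))

  sum-single : (f : Vector ℝ n) (j : Fin n) → (∀ k → k ≢ j → f k ≡ 0#) → sum f ≡ f j
  sum-single f zero    p = trans (cong (f zero +_) (sum-zero (λ i → p (suc i) λ ())))
    (solve 1 (λ x → x :+ lit 0 := x) refl _)
  sum-single f (suc j) p = trans
    (cong₂ _+_ (p zero λ ()) (sum-single (f ∘ suc) j (λ k k≢j → p (suc k) (k≢j ∘ Fin.suc-injective))))
    (solve 1 (λ x → lit 0 :+ x := x) refl _)

  -- Shaped so that `offDiagonalSum A i` is definitionally an instance, as is the off-diagonal part
  -- of a matrix-vector product.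
  sumExcept : Fin n → Vector ℝ n → ℝ
  sumExcept i f = sum (λ j → if does (i Fin.≟ j) then 0# else f j)

  sum≡f+sumExcept : (i : Fin n) (f : Vector ℝ n) → sum f ≡ f i + sumExcept i f
  sum≡f+sumExcept i f = begin
    sum f                             ≡⟨ sum-cong-≗ split ⟩
    sum (λ j → at j + off j)          ≡⟨ ∑-distrib-+ at off ⟩
    sum at + sumExcept i f            ≡⟨ cong (_+ sumExcept i f) (sum-single at i at≡0) ⟩
    at i + sumExcept i f              ≡⟨ cong (λ c → (if c then f i else 0#) + sumExcept i f) (dec-true (i Fin.≟ i) refl) ⟩
    f i + sumExcept i f               ∎
    where
    at off : Vector ℝ _
    at  j = if does (i Fin.≟ j) then f j else 0#
    off j = if does (i Fin.≟ j) then 0# else f j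
    split : ∀ j → f j ≡ at j + off j
    split j with does (i Fin.≟ j)
    ... | true  = solve 1 (λ x → x := x :+ lit 0) refl _
    ... | false = solve 1 (λ x → x := lit 0 :+ x) refl _
    at≡0 : ∀ k → k ≢ i → at k ≡ 0#
    at≡0 k k≢i = cong (if_then f k else 0#) (dec-false (i Fin.≟ k) (k≢i ∘ sym))

  ∣x∣≤‖x‖ : (x : Vector ℝ n) (i : Fin n) → ∣ x i ∣ ≤ ‖ x ‖ᵥ
  ∣x∣≤‖x‖ x zero    = x≤x⊔y _ _
  ∣x∣≤‖x‖ x (suc i) = ≤-trans (∣x∣≤‖x‖ (x ∘ suc) i) (x≤y⊔x _ _)

  ‖x‖≤ : {x : Vector ℝ n} {a : ℝ} → 0# ≤ a → (∀ i → ∣ x i ∣ ≤ a) → ‖ x ‖ᵥ ≤ a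
  ‖x‖≤ {zero}  0≤a p = 0≤a
  ‖x‖≤ {suc n} 0≤a p = ⊔-lub (p zero) (‖x‖≤ 0≤a (p ∘ suc))

  0≤‖x‖ : (x : Vector ℝ n) → 0# ≤ ‖ x ‖ᵥ
  0≤‖x‖ {zero}  x = ≤-refl
  0≤‖x‖ {suc n} x = ≤-trans (0≤∣x∣ (x zero)) (∣x∣≤‖x‖ x zero)

  rowSum≤‖A‖ : (A : Matrix n) (i : Fin n) → sum (λ j → ∣ A i j ∣) ≤ ‖ A ‖
  rowSum≤‖A‖ A i = ≤-trans (x≤∣x∣ _) (∣x∣≤‖x‖ (λ i → sum (λ j → ∣ A i j ∣)) i)

  ∣Ax∣≤ : (A : Matrix n) {x : Vector ℝ n} {a : ℝ} → 0# ≤ a → (∀ j → ∣ x j ∣ ≤ a) →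
          ∀ i → ∣ (A ·ᵥ x) i ∣ ≤ ‖ A ‖ * a
  ∣Ax∣≤ A {x} {a} 0≤a p i = ≤-trans (∣sum∣≤sum∣∣ (λ j → A i j * x j)) (≤-trans
    (sum-mono-≤ (λ j → subst (_≤ ∣ A i j ∣ * a) (sym (∣x*y∣≡∣x∣*∣y∣ _ _)) (*-monoˡ-≤ (0≤∣x∣ (A i j)) (p j))))
    (subst (_≤ ‖ A ‖ * a) (*-distribʳ-sum a (λ j → ∣ A i j ∣)) (*-monoʳ-≤ 0≤a (rowSum≤‖A‖ A i))))

  ·ᵥ-cong : {A A′ : Matrix n} {x x′ : Vector ℝ n} → A ≐ A′ → (∀ j → x j ≡ x′ j) →
            ∀ i → (A ·ᵥ x) i ≡ (A′ ·ᵥ x′) i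
  ·ᵥ-cong p q i = sum-cong-≗ (λ j → cong₂ _*_ (p i j) (q j))

  ·ᵥ-congʳ : (A : Matrix n) {x x′ : Vector ℝ n} → (∀ j → x j ≡ x′ j) →
             ∀ i → (A ·ᵥ x) i ≡ (A ·ᵥ x′) i
  ·ᵥ-congʳ A = ·ᵥ-cong {A = A} (λ _ _ → refl)

  ·ᵥ-+ : (A : Matrix n) (x y : Vector ℝ n) → ∀ i → (A ·ᵥ (λ j → x j + y j)) i ≡ (A ·ᵥ x) i + (A ·ᵥ y) i
  ·ᵥ-+ A x y i = trans
    (sum-cong-≗ (λ j → solve 3 (λ a x y → a :* (x :+ y) := a :* x :+ a :* y) refl (A i j) (x j) (y j)))
    (∑-distrib-+ (λ j → A i j * x j) (λ j → A i j * y j))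

  ·ᵥ-* : (A : Matrix n) (c : ℝ) (x : Vector ℝ n) → ∀ i → (A ·ᵥ (λ j → c * x j)) i ≡ c * (A ·ᵥ x) i
  ·ᵥ-* A c x i = trans
    (sum-cong-≗ (λ j → solve 3 (λ a c x → a :* (c :* x) := c :* (a :* x)) refl (A i j) c (x j)))
    (sym (*-distribˡ-sum c (λ j → A i j * x j)))

  ·ᵥ-neg : (A : Matrix n) (x : Vector ℝ n) → ∀ i → (A ·ᵥ (λ j → - x j)) i ≡ - (A ·ᵥ x) i
  ·ᵥ-neg A x i = begin
    (A ·ᵥ (λ j → - x j)) i        ≡⟨ ·ᵥ-congʳ A (λ j → solve 1 (λ x → :- x := :- (lit 1) :* x) refl (x j)) i ⟩
    (A ·ᵥ (λ j → - 1# * x j)) i   ≡⟨ ·ᵥ-* A (- 1#) x i ⟩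
    - 1# * (A ·ᵥ x) i             ≡⟨ solve 1 (λ x → :- (lit 1) :* x := :- x) refl _ ⟩
    - (A ·ᵥ x) i                  ∎

  ·ᵥ-- : (A : Matrix n) (x y : Vector ℝ n) → ∀ i → (A ·ᵥ (λ j → x j - y j)) i ≡ (A ·ᵥ x) i - (A ·ᵥ y) i
  ·ᵥ-- A x y i = trans (·ᵥ-+ A x (-_ ∘ y) i) (cong ((A ·ᵥ x) i +_) (·ᵥ-neg A y i))

  ·ᵥ-assoc : (A B : Matrix n) (x : Vector ℝ n) → ∀ i → ((A · B) ·ᵥ x) i ≡ (A ·ᵥ (B ·ᵥ x)) i
  ·ᵥ-assoc A B x i = begin
    sum (λ j → sum (λ k → A i k * B k j) * x j)    ≡⟨ sum-cong-≗ (λ j → *-distribʳ-sum (x j) (λ k → A i k * B k j)) ⟩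
    sum (λ j → sum (λ k → A i k * B k j * x j))    ≡⟨ ∑-comm (λ j k → A i k * B k j * x j) ⟩
    sum (λ k → sum (λ j → A i k * B k j * x j))    ≡⟨ sum-cong-≗ (λ k → sum-cong-≗ (λ j →
                                                        solve 3 (λ a b c → a :* b :* c := a :* (b :* c)) refl (A i k) (B k j) (x j))) ⟩
    sum (λ k → sum (λ j → A i k * (B k j * x j)))  ≡⟨ sum-cong-≗ (λ k → *-distribˡ-sum (A i k) (λ j → B k j * x j)) ⟨
    sum (λ k → A i k * sum (λ j → B k j * x j))    ∎

  diagonal-·ᵥ : (σ x : Vector ℝ n) → ∀ i → (diagonal σ ·ᵥ x) i ≡ σ i * x i
  diagonal-·ᵥ σ x i = trans
    (sum-single _ i (λ k k≢i → trans
      (cong (λ c → (if c then σ i else 0#) * x k) (dec-false (i Fin.≟ k) (k≢i ∘ sym)))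
      (solve 1 (λ x → lit 0 :* x := lit 0) refl _)))
    (cong (λ c → (if c then σ i else 0#) * x i) (dec-true (i Fin.≟ i) refl))

  I-·ᵥ : (x : Vector ℝ n) → ∀ i → (I ·ᵥ x) i ≡ x i
  I-·ᵥ x i = trans (diagonal-·ᵥ _ x i) (solve 1 (λ x → lit 1 :* x := x) refl _)

  inverse-·ᵥ : {A B : Matrix n} → A · B ≐ I → (x : Vector ℝ n) → ∀ i → (A ·ᵥ (B ·ᵥ x)) i ≡ x i
  inverse-·ᵥ {A = A} {B} p x i = trans (sym (·ᵥ-assoc A B x i)) (trans (·ᵥ-cong p (λ _ → refl) i) (I-·ᵥ x i))

  -- The scalar core of the pseudo-inverse identities, applied to each eigenvalue; at 0 both sides
  -- vanish.
  reciprocal₀-* : ∀ x → reciprocal₀ x * (x * x) ≡ x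
  reciprocal₀-* x with x ≟ 0#
  ... | yes refl = solve 0 (lit 0 :* (lit 0 :* lit 0) := lit 0) refl
  ... | no  x≢0  = begin
    x ⁻¹ * (x * x)   ≡⟨ solve 2 (λ x y → y :* (x :* x) := y :* x :* x) refl x (x ⁻¹) ⟩
    x ⁻¹ * x * x     ≡⟨ cong (_* x) (*-inverseˡ x≢0) ⟩
    1# * x           ≡⟨ solve 1 (λ x → lit 1 :* x := x) refl x ⟩
    x                ∎

  module _ {A : Matrix n} where

    conjugate-·ᵥ : {V : Matrix n} {σ : Vector ℝ n} → A ≐ V · diagonal σ · V ᵀ → (x : Vector ℝ n) →
                   ∀ i → (A ·ᵥ x) i ≡ (V ·ᵥ (λ j → σ j * (V ᵀ ·ᵥ x) j)) i
    conjugate-·ᵥ {V} {σ} eq x i = begin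
      (A ·ᵥ x) i                                  ≡⟨ ·ᵥ-cong eq (λ _ → refl) i ⟩
      ((V · diagonal σ · V ᵀ) ·ᵥ x) i             ≡⟨ ·ᵥ-assoc (V · diagonal σ) (V ᵀ) x i ⟩
      ((V · diagonal σ) ·ᵥ (V ᵀ ·ᵥ x)) i          ≡⟨ ·ᵥ-assoc V (diagonal σ) (V ᵀ ·ᵥ x) i ⟩
      (V ·ᵥ (diagonal σ ·ᵥ (V ᵀ ·ᵥ x))) i         ≡⟨ ·ᵥ-congʳ V (diagonal-·ᵥ σ (V ᵀ ·ᵥ x)) i ⟩
      (V ·ᵥ (λ j → σ j * (V ᵀ ·ᵥ x) j)) i         ∎

  module _ {A B : Matrix n} where

    private
      -- In the basis `V` the matrices act by entrywise multiplication: `τ` holds the coordinates of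
      -- `D ·ᵥ y`, and orthogonality of `V` recovers them, so products of such matrices reduce to
      -- products of eigenvalues.
      conjugate-·ᵥ₂ : {C D : Matrix n} {V : Matrix n} {σ τ : Vector ℝ n} → V ᵀ · V ≐ I →
        C ≐ V · diagonal σ · V ᵀ → (y : Vector ℝ n) → (∀ j → (D ·ᵥ y) j ≡ (V ·ᵥ τ) j) →
        ∀ i → (C ·ᵥ (D ·ᵥ y)) i ≡ (V ·ᵥ (λ j → σ j * τ j)) i
      conjugate-·ᵥ₂ {C} {D} {V} {σ} {τ} VᵀV≐I eq y p i = begin
        (C ·ᵥ (D ·ᵥ y)) i                             ≡⟨ conjugate-·ᵥ {A = C} {V} {σ} eq (D ·ᵥ y) i ⟩
        (V ·ᵥ (λ j → σ j * (V ᵀ ·ᵥ (D ·ᵥ y)) j)) i    ≡⟨ ·ᵥ-congʳ V (λ j → cong (σ j *_)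
                                                          (trans (·ᵥ-congʳ (V ᵀ) p j) (inverse-·ᵥ {A = V ᵀ} {V} VᵀV≐I τ j))) i ⟩
        (V ·ᵥ (λ j → σ j * τ j)) i                    ∎

    -- This makes `B ·ᵥ b` a solution of the system for every `b` in the range of `A`.
    ABA≡A : InverseOrPseudoInverse A B → ∀ x i → (A ·ᵥ (B ·ᵥ (A ·ᵥ x))) i ≡ (A ·ᵥ x) i
    ABA≡A (inverse (AB≐I , _)) x i = inverse-·ᵥ AB≐I (A ·ᵥ x) i
    ABA≡A (pseudoInverse _ _ V σ (_ , VᵀV≐I) A≐ B≐) x i = begin
      (A ·ᵥ (B ·ᵥ (A ·ᵥ x))) i   ≡⟨ conjugate-·ᵥ₂ {A} {B} {V} {σ} VᵀV≐I A≐ (A ·ᵥ x)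
                                      (conjugate-·ᵥ₂ {B} {A} {V} VᵀV≐I B≐ x (conjugate-·ᵥ {A = A} A≐ x)) i ⟩
      (V ·ᵥ (λ j → σ j * (reciprocal₀ (σ j) * (σ j * (V ᵀ ·ᵥ x) j)))) i
                                 ≡⟨ ·ᵥ-congʳ V (λ j → trans
                                      (solve 3 (λ s r w → s :* (r :* (s :* w)) := r :* (s :* s) :* w) refl (σ j) (reciprocal₀ (σ j)) _)
                                      (cong (_* (V ᵀ ·ᵥ x) j) (reciprocal₀-* (σ j)))) i ⟩
      (V ·ᵥ (λ j → σ j * (V ᵀ ·ᵥ x) j)) i
                                 ≡⟨ conjugate-·ᵥ {A = A} A≐ x i ⟨
      (A ·ᵥ x) i                 ∎

    -- In the singular case `A` and `B` share the eigenvectors `V`, so `B · A` is the orthogonal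
    -- projection onto the range of `A` and fixes that range.
    BAA≡A : InverseOrPseudoInverse A B → ∀ x i → (B ·ᵥ (A ·ᵥ (A ·ᵥ x))) i ≡ (A ·ᵥ x) i
    BAA≡A (inverse (_ , BA≐I)) x i = inverse-·ᵥ BA≐I (A ·ᵥ x) i
    BAA≡A (pseudoInverse _ _ V σ (_ , VᵀV≐I) A≐ B≐) x i = begin
      (B ·ᵥ (A ·ᵥ (A ·ᵥ x))) i   ≡⟨ conjugate-·ᵥ₂ {B} {A} {V} VᵀV≐I B≐ (A ·ᵥ x)
                                      (conjugate-·ᵥ₂ {A} {A} {V} {σ} VᵀV≐I A≐ x (conjugate-·ᵥ {A = A} A≐ x)) i ⟩
      (V ·ᵥ (λ j → reciprocal₀ (σ j) * (σ j * (σ j * (V ᵀ ·ᵥ x) j)))) i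
                                 ≡⟨ ·ᵥ-congʳ V (λ j → trans
                                      (solve 3 (λ s r w → r :* (s :* (s :* w)) := r :* (s :* s) :* w) refl (σ j) (reciprocal₀ (σ j)) _)
                                      (cong (_* (V ᵀ ·ᵥ x) j) (reciprocal₀-* (σ j)))) i ⟩
      (V ·ᵥ (λ j → σ j * (V ᵀ ·ᵥ x) j)) i
                                 ≡⟨ conjugate-·ᵥ {A = A} A≐ x i ⟨
      (A ·ᵥ x) i                 ∎

    BA≡I : NonSingular A → InverseOrPseudoInverse A B → ∀ x i → (B ·ᵥ (A ·ᵥ x)) i ≡ x i
    BA≡I _  (inverse (_ , BA≐I))                x i = inverse-·ᵥ BA≐I x i
    BA≡I ns (pseudoInverse singular _ _ _ _ _ _) x i = contradiction ns singular

    sgn-diagonal : NonZeroDiagonalOfOneSign A → ∀ i j → sgn (A i i) ≡ sgn (A j j)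
    sgn-diagonal (inj₁ 0<) i j = trans (sgn≡1 (0< i)) (sym (sgn≡1 (0< j)))
      where
      sgn≡1 : ∀ {x} → 0# < x → sgn x ≡ 1#
      sgn≡1 {x} p = cong (if_then 1# else - 1#) (dec-true (0# ≤? x) (proj₁ p))
    sgn-diagonal (inj₂ <0) i j = trans (sgn≡-1 (<0 i)) (sym (sgn≡-1 (<0 j)))
      where
      sgn≡-1 : ∀ {x} → x < 0# → sgn x ≡ - 1#
      sgn≡-1 {x} p = cong (if_then 1# else - 1#) (dec-false (0# ≤? x) (<⇒≱ p))

    -- Exchanges `x` for the signed vector, which is the one that occurs in the residual equation.
    -- Without a kernel both sides are 0; with a diagonal of one sign, the sign is a scalar that
    -- commutes with both matrices and disappears in the absolute value.
    kernelPart-sgn : InverseOrPseudoInverse A B → NonSingular A ⊎ NonZeroDiagonalOfOneSign A → ∀ x i →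
      ∣ x i - (B ·ᵥ (A ·ᵥ x)) i ∣ ≡
      ∣ sgn (A i i) * x i - (B ·ᵥ (A ·ᵥ (λ j → sgn (A j j) * x j))) i ∣
    kernelPart-sgn p (inj₁ ns) x i = cong ∣_∣ (trans (vanishes x) (sym (vanishes (λ j → sgn (A j j) * x j))))
      where
      vanishes : ∀ y → y i - (B ·ᵥ (A ·ᵥ y)) i ≡ 0#
      vanishes y = trans (cong (λ c → y i - c) (BA≡I ns p y i)) (solve 1 (λ y → y :- y := lit 0) refl _)
    kernelPart-sgn _ (inj₂ sd) x i = begin
      ∣ x i - (B ·ᵥ (A ·ᵥ x)) i ∣            ≡⟨ ∣sgn*y∣≡∣y∣ (A i i) _ ⟨
      ∣ s * (x i - (B ·ᵥ (A ·ᵥ x)) i) ∣      ≡⟨ cong ∣_∣ (solve 3 (λ s x y → s :* (x :- y) := s :* x :- s :* y) refl s (x i) _) ⟩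
      ∣ s * x i - s * (B ·ᵥ (A ·ᵥ x)) i ∣    ≡⟨ cong (λ c → ∣ s * x i - c ∣) (·ᵥ-* B s (A ·ᵥ x) i) ⟨
      ∣ s * x i - (B ·ᵥ (λ j → s * (A ·ᵥ x) j)) i ∣
        ≡⟨ cong (λ c → ∣ s * x i - c ∣) (·ᵥ-congʳ B (λ j → trans (sym (·ᵥ-* A s x j))
             (·ᵥ-congʳ A (λ k → cong (_* x k) (sgn-diagonal sd i k)) j)) i) ⟩
      ∣ s * x i - (B ·ᵥ (A ·ᵥ (λ j → sgn (A j j) * x j))) i ∣ ∎
      where s = sgn (A i i)

-- Jacobi iteration with a shifted diagonal: boundedness, convergence and bias

module RegularisedJacobi (F : OrderedField) where
  open OrderedField F
  open LinearAlgebra F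
  open FieldProperties F
  open LinearAlgebraProperties F
  open IntegerSolver F
  open ≡-Reasoning

  pivot : ℝ → ℝ → ℝ
  pivot δ a = sgn a * (∣ a ∣ + δ)

  pivot≡ : ∀ δ a → pivot δ a ≡ a + δ * sgn a
  pivot≡ δ a = trans
    (solve 3 (λ s x d → s :* (x :+ d) := s :* x :+ d :* s) refl (sgn a) (∣ a ∣) δ)
    (cong (_+ δ * sgn a) (sym (x≡sgn*∣x∣ a)))

  ∣pivot∣ : ∀ {δ} a → 0# ≤ δ → ∣ pivot δ a ∣ ≡ ∣ a ∣ + δ
  ∣pivot∣ a 0≤δ = trans (∣sgn*y∣≡∣y∣ a _) (0≤x⇒∣x∣≡x (0≤+ (0≤∣x∣ a) 0≤δ))

  module _ {n} (S : Matrix n) (b : Vector ℝ n) (δ : ℝ) where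

    D : Vector ℝ n
    D i = pivot δ (S i i)

    off : Vector ℝ n → Vector ℝ n
    off x i = sumExcept i (λ j → S i j * x j)

    -- The Jacobi iterates of the system whose diagonal is D.
    w : ℕ → Vector ℝ n
    w zero    i = 0#
    w (suc k) i = (b i - off (w k) i) / D i

    off≡ : ∀ x i → off x i ≡ (S ·ᵥ x) i - S i i * x i
    off≡ x i = begin
      off x i                                  ≡⟨ solve 2 (λ o a → o := (a :+ o) :- a) refl (off x i) (S i i * x i) ⟩
      S i i * x i + off x i - S i i * x i      ≡⟨ cong (_- S i i * x i) (sum≡f+sumExcept i (λ j → S i j * x j)) ⟨
      (S ·ᵥ x) i - S i i * x i                 ∎

    off-- : ∀ x y i → off x i - off y i ≡ off (λ j → x j - y j) i
    off-- x y i = begin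
      off x i - off y i
        ≡⟨ cong₂ _-_ (off≡ x i) (off≡ y i) ⟩
      ((S ·ᵥ x) i - S i i * x i) - ((S ·ᵥ y) i - S i i * y i)
        ≡⟨ solve 5 (λ p q a x y → (p :- a :* x) :- (q :- a :* y) := (p :- q) :- a :* (x :- y)) refl
             ((S ·ᵥ x) i) ((S ·ᵥ y) i) (S i i) (x i) (y i) ⟩
      ((S ·ᵥ x) i - (S ·ᵥ y) i) - S i i * (x i - y i)
        ≡⟨ cong (_- S i i * (x i - y i)) (·ᵥ-- S x y i) ⟨
      (S ·ᵥ (λ j → x j - y j)) i - S i i * (x i - y i)
        ≡⟨ off≡ (λ j → x j - y j) i ⟨
      off (λ j → x j - y j) i ∎

    module _ (dominant : DiagonallyDominant S) (0<δ : 0# < δ) where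

      ∣off∣≤ : ∀ {x a} → 0# ≤ a → (∀ j → ∣ x j ∣ ≤ a) → ∀ i → ∣ off x i ∣ ≤ ∣ S i i ∣ * a
      ∣off∣≤ {x} {a} 0≤a p i = ≤-trans (∣sum∣≤sum∣∣ term) (≤-trans (sum-mono-≤ bound)
        (subst (_≤ ∣ S i i ∣ * a) (*-distribʳ-sum a entry) (*-monoʳ-≤ 0≤a (dominant i))))
        where
        term entry : Vector ℝ n
        term  j = if does (i Fin.≟ j) then 0# else S i j * x j
        entry j = if does (i Fin.≟ j) then 0# else ∣ S i j ∣
        bound : ∀ j → ∣ term j ∣ ≤ entry j * a
        bound j with does (i Fin.≟ j)
        ... | true  = ≤-reflexive (trans (0≤x⇒∣x∣≡x ≤-refl) (solve 1 (λ a → lit 0 := lit 0 :* a) refl a))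
        ... | false = subst (_≤ ∣ S i j ∣ * a) (sym (∣x*y∣≡∣x∣*∣y∣ (S i j) (x j))) (*-monoˡ-≤ (0≤∣x∣ (S i j)) (p j))

      0<∣a∣+δ : ∀ a → 0# < ∣ a ∣ + δ
      0<∣a∣+δ a = <-≤-trans 0<δ (≤-by (0≤∣x∣ a) (solve 2 (λ a d → (a :+ d) :- d := a) refl (∣ a ∣) δ))

      D≢0 : ∀ i → D i ≢ 0#
      D≢0 i D≡0 = 0<⇒≢0 (0<∣a∣+δ (S i i)) (trans (sym (∣pivot∣ (S i i) (proj₁ 0<δ)))
        (trans (cong ∣_∣ D≡0) (0≤x⇒∣x∣≡x ≤-refl)))

      D-cancel : ∀ {x a} i → ∣ D i * x ∣ ≤ (∣ S i i ∣ + δ) * a → ∣ x ∣ ≤ a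
      D-cancel {x} {a} i p = *-cancelˡ-≤ (0<∣a∣+δ (S i i)) (subst (_≤ (∣ S i i ∣ + δ) * a)
        (trans (∣x*y∣≡∣x∣*∣y∣ (D i) x) (cong (_* ∣ x ∣) (∣pivot∣ (S i i) (proj₁ 0<δ)))) p)

      D*w : ∀ k i → D i * w (suc k) i ≡ b i - off (w k) i
      D*w k i = trans (solve 2 (λ x y → x :* y := y :* x) refl (D i) (w (suc k) i)) (/-*-cancel _ (D≢0 i))

      module _ {z : Vector ℝ n} {Z : ℝ} (Sz≡b : ∀ i → (S ·ᵥ z) i ≡ b i) (∣z∣≤Z : ∀ i → ∣ z i ∣ ≤ Z)
               (0≤Z : 0# ≤ Z) where

        -- Multiplied by the pivot, the new error consists of an off-diagonal part, at most
        -- `∣ S i i ∣ * Z` by dominance and induction, and the effect of the shift on `z`, at most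
        -- `δ * Z`. Together they are the absolute value of the pivot times `Z`. Summing a geometric
        -- series instead would cost a factor `1 / (1 - ρ)`.
        ∣w-z∣≤Z : ∀ k i → ∣ w k i - z i ∣ ≤ Z
        ∣w-z∣≤Z zero i = subst (_≤ Z)
          (trans (sym (∣-x∣≡∣x∣ (z i))) (cong ∣_∣ (solve 1 (λ z → :- z := lit 0 :- z) refl (z i)))) (∣z∣≤Z i)
        ∣w-z∣≤Z (suc k) i = D-cancel i (subst (_≤ (∣ S i i ∣ + δ) * Z) (cong ∣_∣ (sym eq)) bound)
          where
          e : Vector ℝ n
          e j = z j - w k j
          ∣e∣≤Z : ∀ j → ∣ e j ∣ ≤ Z
          ∣e∣≤Z j = subst (_≤ Z) (trans (sym (∣-x∣≡∣x∣ _))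
            (cong ∣_∣ (solve 2 (λ w z → :- (w :- z) := z :- w) refl (w k j) (z j)))) (∣w-z∣≤Z k j)
          eq : D i * (w (suc k) i - z i) ≡ off e i - δ * (sgn (S i i) * z i)
          eq = begin
            D i * (w (suc k) i - z i)
              ≡⟨ solve 3 (λ d w z → d :* (w :- z) := d :* w :- d :* z) refl (D i) (w (suc k) i) (z i) ⟩
            D i * w (suc k) i - D i * z i
              ≡⟨ cong₂ (λ x y → x - y * z i) (D*w k i) (pivot≡ δ (S i i)) ⟩
            (b i - off (w k) i) - (S i i + δ * sgn (S i i)) * z i
              ≡⟨ cong (λ x → (x - off (w k) i) - (S i i + δ * sgn (S i i)) * z i) (Sz≡b i) ⟨
            ((S ·ᵥ z) i - off (w k) i) - (S i i + δ * sgn (S i i)) * z i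
              ≡⟨ solve 6 (λ p o a d s z → (p :- o) :- (a :+ d :* s) :* z := ((p :- a :* z) :- o) :- d :* (s :* z)) refl
                   ((S ·ᵥ z) i) (off (w k) i) (S i i) δ (sgn (S i i)) (z i) ⟩
            (((S ·ᵥ z) i - S i i * z i) - off (w k) i) - δ * (sgn (S i i) * z i)
              ≡⟨ cong (λ x → (x - off (w k) i) - δ * (sgn (S i i) * z i)) (off≡ z i) ⟨
            (off z i - off (w k) i) - δ * (sgn (S i i) * z i)
              ≡⟨ cong (_- δ * (sgn (S i i) * z i)) (off-- z (w k) i) ⟩
            off e i - δ * (sgn (S i i) * z i) ∎
          ∣δsz∣ : ∣ δ * (sgn (S i i) * z i) ∣ ≤ δ * Z
          ∣δsz∣ = subst (_≤ δ * Z)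
            (sym (trans (∣x*y∣≡∣x∣*∣y∣ δ _) (cong₂ _*_ (0≤x⇒∣x∣≡x (proj₁ 0<δ)) (∣sgn*y∣≡∣y∣ (S i i) (z i)))))
            (*-monoˡ-≤ (proj₁ 0<δ) (∣z∣≤Z i))
          bound : ∣ off e i - δ * (sgn (S i i) * z i) ∣ ≤ (∣ S i i ∣ + δ) * Z
          bound = ≤-trans (∣x-y∣≤∣x∣+∣y∣ _ _) (subst (∣ off e i ∣ + ∣ δ * (sgn (S i i) * z i) ∣ ≤_)
            (solve 3 (λ a d z → a :* z :+ d :* z := (a :+ d) :* z) refl (∣ S i i ∣) δ Z)
            (+-mono-≤ (∣off∣≤ 0≤Z ∣e∣≤Z i) ∣δsz∣))

        ∣w∣≤2Z : ∀ k i → ∣ w k i ∣ ≤ fromℕ 2 * Z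
        ∣w∣≤2Z k i = subst₂ _≤_ (cong ∣_∣ (solve 2 (λ w z → (w :- z) :+ z := w) refl (w k i) (z i))) (sym (two* Z))
          (≤-trans (∣x+y∣≤∣x∣+∣y∣ _ _) (+-mono-≤ (∣w-z∣≤Z k i) (∣z∣≤Z i)))

        r : ℕ → Vector ℝ n
        r k i = w (suc k) i - w k i

        module _ {ρ : ℝ} (0≤ρ : 0# ≤ ρ) (contractive : ∀ i → ∣ S i i ∣ ≤ ρ * (∣ S i i ∣ + δ)) where

          -- The right-hand side `b` cancels between consecutive iterates, so their differences obey
          -- the homogeneous recursion, whose factor is `ρ`. The initial 2 arises because both first
          -- iterates lie within `Z` of `z`.
          ∣r∣≤ : ∀ k i → ∣ r k i ∣ ≤ ρ ^ k * (fromℕ 2 * Z)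
          ∣r∣≤ zero i = subst₂ _≤_
            (cong ∣_∣ (solve 3 (λ w′ w z → (w′ :- z) :- (w :- z) := w′ :- w) refl (w 1 i) (w 0 i) (z i)))
            (trans (sym (two* Z)) (solve 1 (λ x → x := lit 1 :* x) refl _))
            (≤-trans (∣x-y∣≤∣x∣+∣y∣ _ _) (+-mono-≤ (∣w-z∣≤Z 1 i) (∣w-z∣≤Z 0 i)))
          ∣r∣≤ (suc k) i = D-cancel i (subst (_≤ (∣ S i i ∣ + δ) * (ρ ^ suc k * (fromℕ 2 * Z)))
            (trans (sym (∣-x∣≡∣x∣ _)) (cong ∣_∣ (sym eq)))
            (≤-trans (∣off∣≤ 0≤a (∣r∣≤ k) i) (subst (∣ S i i ∣ * a ≤_)
              (solve 4 (λ p x d y → p :* d :* (x :* y) := d :* (p :* x :* y)) refl ρ (ρ ^ k) (∣ S i i ∣ + δ) (fromℕ 2 * Z))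
              (*-monoʳ-≤ 0≤a (contractive i)))))
            where
            a = ρ ^ k * (fromℕ 2 * Z)
            0≤a : 0# ≤ a
            0≤a = *-nonNeg (0≤x^n k 0≤ρ) (*-nonNeg (0≤fromℕ 2) 0≤Z)
            eq : D i * r (suc k) i ≡ - off (r k) i
            eq = begin
              D i * (w (suc (suc k)) i - w (suc k) i)
                ≡⟨ solve 3 (λ d w z → d :* (w :- z) := d :* w :- d :* z) refl (D i) _ _ ⟩
              D i * w (suc (suc k)) i - D i * w (suc k) i
                ≡⟨ cong₂ _-_ (D*w (suc k) i) (D*w k i) ⟩
              (b i - off (w (suc k)) i) - (b i - off (w k) i)
                ≡⟨ solve 3 (λ b o p → (b :- o) :- (b :- p) := :- (o :- p)) refl (b i) _ _ ⟩
              - (off (w (suc k)) i - off (w k) i)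
                ≡⟨ cong -_ (off-- (w (suc k)) (w k) i) ⟩
              - off (r k) i ∎

          module _ {B : Matrix n} (S⁻¹≡B : InverseOrPseudoInverse S B)
                   (condition : NonSingular S ⊎ NonZeroDiagonalOfOneSign S)
                   (BSz≡z : ∀ i → (B ·ᵥ (S ·ᵥ z)) i ≡ z i)
                   {L : ℝ} (D≤Lδ : ∀ i → ∣ S i i ∣ + δ ≤ L * δ) (0≤L : 0# ≤ L) (T : ℕ) where

            private
              y s·w : Vector ℝ n
              y i = D i * r T i
              s·w i = sgn (S i i) * w T i

              -- With the factor `δ` split off, this bounds the residual `y`: the pivot is at most
              -- `L * δ` and the last difference at most the remaining factor.
              Y = L * (ρ ^ T * (fromℕ 2 * Z))

              Π : Vector ℝ n → Vector ℝ n
              Π x = B ·ᵥ (S ·ᵥ x)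

              e : Vector ℝ n
              e j = w T j - z j

              0≤a : 0# ≤ ρ ^ T * (fromℕ 2 * Z)
              0≤a = *-nonNeg (0≤x^n T 0≤ρ) (*-nonNeg (0≤fromℕ 2) 0≤Z)

              0≤δY : 0# ≤ δ * Y
              0≤δY = *-nonNeg (proj₁ 0<δ) (*-nonNeg 0≤L 0≤a)

              ∣y∣≤ : ∀ i → ∣ y i ∣ ≤ δ * Y
              ∣y∣≤ i = subst₂ _≤_
                (sym (trans (∣x*y∣≡∣x∣*∣y∣ (D i) (r T i)) (cong (_* ∣ r T i ∣) (∣pivot∣ (S i i) (proj₁ 0<δ)))))
                (solve 3 (λ l d a → l :* d :* a := d :* (l :* a)) refl L δ _)
                (≤-trans (*-monoˡ-≤ (proj₁ (0<∣a∣+δ (S i i))) (∣r∣≤ T i)) (*-monoʳ-≤ 0≤a (D≤Lδ i)))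

              residual : ∀ i → (S ·ᵥ e) i ≡ - (δ * s·w i + y i)
              residual i = begin
                (S ·ᵥ e) i                     ≡⟨ ·ᵥ-- S (w T) z i ⟩
                (S ·ᵥ w T) i - (S ·ᵥ z) i      ≡⟨ cong (λ c → (S ·ᵥ w T) i - c) (Sz≡b i) ⟩
                (S ·ᵥ w T) i - b i
                  ≡⟨ solve 6 (λ p b a x d s → p :- b := :- (d :* (s :* x) :+ ((b :- (p :- a :* x)) :- (a :+ d :* s) :* x))) refl
                       ((S ·ᵥ w T) i) (b i) (S i i) (w T i) δ (sgn (S i i)) ⟩
                - (δ * s·w i + ((b i - ((S ·ᵥ w T) i - S i i * w T i)) - (S i i + δ * sgn (S i i)) * w T i))
                  ≡⟨ cong₂ (λ c d → - (δ * s·w i + ((b i - c) - d * w T i))) (off≡ (w T) i) (pivot≡ δ (S i i)) ⟨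
                - (δ * s·w i + ((b i - off (w T) i) - D i * w T i))
                  ≡⟨ cong (λ c → - (δ * s·w i + (c - D i * w T i))) (D*w T i) ⟨
                - (δ * s·w i + (D i * w (suc T) i - D i * w T i))
                  ≡⟨ cong (λ c → - (δ * s·w i + c))
                       (solve 3 (λ d w z → d :* (w :- z) := d :* w :- d :* z) refl (D i) (w (suc T) i) (w T i)) ⟨
                - (δ * s·w i + y i) ∎

              rangePart : ∀ i → ∣ Π e i ∣ ≤ ‖ B ‖ * (δ * (fromℕ 2 * Z) + δ * Y)
              rangePart i = ∣Ax∣≤ B (0≤+ (*-nonNeg (proj₁ 0<δ) (*-nonNeg (0≤fromℕ 2) 0≤Z)) 0≤δY) bound i
                where
                bound : ∀ j → ∣ (S ·ᵥ e) j ∣ ≤ δ * (fromℕ 2 * Z) + δ * Y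
                bound j = subst (_≤ δ * (fromℕ 2 * Z) + δ * Y)
                  (trans (sym (∣-x∣≡∣x∣ _)) (cong ∣_∣ (sym (residual j))))
                  (≤-trans (∣x+y∣≤∣x∣+∣y∣ _ _) (+-mono-≤
                    (subst (_≤ δ * (fromℕ 2 * Z))
                      (sym (trans (∣x*y∣≡∣x∣*∣y∣ δ _) (cong₂ _*_ (0≤x⇒∣x∣≡x (proj₁ 0<δ)) (∣sgn*y∣≡∣y∣ (S j j) (w T j)))))
                      (*-monoˡ-≤ (proj₁ 0<δ) (∣w∣≤2Z T j)))
                    (∣y∣≤ j)))

              -- δ s·w + y = - S e has no component in the kernel of S.
              δ*kernelPart : ∀ i → δ * (s·w i - Π s·w i) ≡ - (y i - Π y i)
              δ*kernelPart i = begin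
                δ * (s·w i - Π s·w i)
                  ≡⟨ solve 5 (λ d s p y q → d :* (s :- p) := ((d :* s :+ y) :- (d :* p :+ q)) :- (y :- q)) refl
                       δ (s·w i) (Π s·w i) (y i) (Π y i) ⟩
                ((δ * s·w i + y i) - (δ * Π s·w i + Π y i)) - (y i - Π y i)
                  ≡⟨ cong (λ c → ((δ * s·w i + y i) - c) - (y i - Π y i)) Πg ⟩
                ((δ * s·w i + y i) - (δ * s·w i + y i)) - (y i - Π y i)
                  ≡⟨ solve 2 (λ a b → (a :- a) :- b := :- b) refl (δ * s·w i + y i) (y i - Π y i) ⟩
                - (y i - Π y i) ∎
                where
                g : Vector ℝ n
                g j = δ * s·w j + y j
                g≡ : ∀ j → g j ≡ - (S ·ᵥ e) j
                g≡ j = trans (solve 1 (λ g → g := :- (:- g)) refl (g j)) (cong -_ (sym (residual j)))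
                g≡S : ∀ j → g j ≡ (S ·ᵥ (λ k → - e k)) j
                g≡S j = trans (g≡ j) (sym (·ᵥ-neg S e j))
                Πg : δ * Π s·w i + Π y i ≡ g i
                Πg = begin
                  δ * Π s·w i + Π y i
                    ≡⟨ cong (_+ Π y i) (·ᵥ-* B δ (S ·ᵥ s·w) i) ⟨
                  (B ·ᵥ (λ j → δ * (S ·ᵥ s·w) j)) i + Π y i
                    ≡⟨ ·ᵥ-+ B (λ j → δ * (S ·ᵥ s·w) j) (S ·ᵥ y) i ⟨
                  (B ·ᵥ (λ j → δ * (S ·ᵥ s·w) j + (S ·ᵥ y) j)) i
                    ≡⟨ ·ᵥ-congʳ B (λ j → trans (·ᵥ-+ S (λ k → δ * s·w k) y j) (cong (_+ (S ·ᵥ y) j) (·ᵥ-* S δ s·w j))) i ⟨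
                  Π g i
                    ≡⟨ ·ᵥ-congʳ B (·ᵥ-congʳ S g≡S) i ⟩
                  Π (S ·ᵥ (λ k → - e k)) i
                    ≡⟨ BAA≡A S⁻¹≡B (λ k → - e k) i ⟩
                  (S ·ᵥ (λ k → - e k)) i
                    ≡⟨ g≡S i ⟨
                  g i ∎

              -- The factor `δ` in the bound on `y` cancels the one in front of the kernel part. The
              -- summand 1 comes from `y` itself and `κ S B` from its image under `Π`.
              kernelPart : ∀ i → ∣ w T i - Π (w T) i ∣ ≤ (1# + κ S B) * Y
              kernelPart i = *-cancelˡ-≤ 0<δ (subst₂ _≤_
                (begin
                  ∣ y i - Π y i ∣              ≡⟨ ∣-x∣≡∣x∣ _ ⟨
                  ∣ - (y i - Π y i) ∣          ≡⟨ cong ∣_∣ (δ*kernelPart i) ⟨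
                  ∣ δ * (s·w i - Π s·w i) ∣    ≡⟨ ∣x*y∣≡∣x∣*∣y∣ δ _ ⟩
                  ∣ δ ∣ * ∣ s·w i - Π s·w i ∣  ≡⟨ cong₂ _*_ (0≤x⇒∣x∣≡x (proj₁ 0<δ)) (sym (kernelPart-sgn S⁻¹≡B condition (w T) i)) ⟩
                  δ * ∣ w T i - Π (w T) i ∣    ∎)
                (solve 4 (λ d y s b → d :* y :+ b :* (s :* (d :* y)) := d :* ((lit 1 :+ s :* b) :* y)) refl δ Y (‖ S ‖) (‖ B ‖))
                (≤-trans (∣x-y∣≤∣x∣+∣y∣ _ _) (+-mono-≤ (∣y∣≤ i)
                  (∣Ax∣≤ B (*-nonNeg (0≤‖x‖ (λ i → sum (λ j → ∣ S i j ∣))) 0≤δY) (∣Ax∣≤ S 0≤δY ∣y∣≤) i))))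

            ∣w-z∣≤ : ∀ i → ∣ w T i - z i ∣ ≤ ‖ B ‖ * δ * (fromℕ 2 * Z + Y) + (1# + κ S B) * Y
            ∣w-z∣≤ i = subst₂ _≤_ (cong ∣_∣ eq)
              (cong (_+ (1# + κ S B) * Y) (solve 4 (λ b d z y → b :* (d :* z :+ d :* y) := b :* d :* (z :+ y)) refl (‖ B ‖) δ (fromℕ 2 * Z) Y))
              (≤-trans (∣x+y∣≤∣x∣+∣y∣ _ _) (+-mono-≤ (rangePart i) (kernelPart i)))
              where
              eq : Π e i + (w T i - Π (w T) i) ≡ w T i - z i
              eq = begin
                Π e i + (w T i - Π (w T) i)
                  ≡⟨ cong (_+ (w T i - Π (w T) i)) (trans (·ᵥ-congʳ B (·ᵥ-- S (w T) z) i) (·ᵥ-- B (S ·ᵥ w T) (S ·ᵥ z) i)) ⟩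
                (Π (w T) i - Π z i) + (w T i - Π (w T) i)
                  ≡⟨ solve 3 (λ p q w → (p :- q) :+ (w :- p) := w :- q) refl (Π (w T) i) (Π z i) (w T i) ⟩
                w T i - Π z i
                  ≡⟨ cong (λ c → w T i - c) (BSz≡z i) ⟩
                w T i - z i ∎

-- Random walk estimates of the Jacobi iterates and their concentration

module RandomWalk (F : OrderedField) where
  open OrderedField F
  open LinearAlgebra F
  open Queries F
  open FieldProperties F
  open LinearAlgebraProperties F
  open RegularisedJacobi F
  open IntegerSolver F
  open ≡-Reasoning

  -- One out-neighbour stands in for the whole off-diagonal sum: it is drawn with probability
  -- `∣ S u v ∣ / d`, so its value is weighted by `sgn (S u v) * d`. The continuation is needed
  -- because the value found further along the walk is still to be rescaled, while an `Algorithm`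
  -- has values only at its leaves.
  walkEstimate : ℝ → ℕ → ℕ → (ℝ → Algorithm) → Algorithm
  walkEstimate δ zero    u next = next 0#
  walkEstimate δ (suc T) u next = vertex u λ _ d a β → walk u (maybe′
    (λ (v , s) → walkEstimate δ T v (λ x → next ((β - sgn s * d * x) / pivot δ a)))
    (next (β / pivot δ a)))

  sumEstimates : ℝ → ℕ → ℕ → ℕ → ℝ → (ℝ → Algorithm) → Algorithm
  sumEstimates δ T u zero    y next = next y
  sumEstimates δ T u (suc N) y next = walkEstimate δ T u (λ x → sumEstimates δ T u N (y + x) next)

  toVertex-toℕ : ∀ {n} (u : Fin n) → toVertex n (toℕ u) ≡ just u
  toVertex-toℕ {n} u with toℕ u ℕ.<? n
  ... | yes u<n = cong just (Fin.fromℕ<-toℕ u u<n)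
  ... | no  u≮n = contradiction (Fin.toℕ<n u) u≮n

  module _ {n} (S : Matrix n) (u : Fin n) where

    noEdge : outNeighbours S u ≡ [] → ∀ v → ¬ Edge S u v
    noEdge eq v e with () ← subst (v ∈_) eq (∈-filter⁺ (edge? S u) (∈-allFin v) e)

    firstEdge : ∀ {v vs} → outNeighbours S u ≡ v ∷ vs → Edge S u v
    firstEdge {v} eq = proj₂ (∈-filter⁻ (edge? S u) {xs = allFin n} (subst (v ∈_) (sym eq) (here refl)))

    private
      entry : Vector ℝ n
      entry v = if does (u Fin.≟ v) then 0# else ∣ S u v ∣

    0≤entry : ∀ v → 0# ≤ entry v
    0≤entry v with does (u Fin.≟ v)
    ... | true  = ≤-refl
    ... | false = 0≤∣x∣ (S u v)

    Edge⇒dᵒᵘᵗ≢0 : ∀ {v} → Edge S u v → dᵒᵘᵗ S u ≢ 0#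
    Edge⇒dᵒᵘᵗ≢0 {v} (u≢v , Suv≢0) d≡0 = Suv≢0 (∣x∣≤0⇒x≡0 (≤-trans
      (≤-reflexive (cong (if_then 0# else ∣ S u v ∣) (sym (dec-false (u Fin.≟ v) u≢v))))
      (≤-trans (≤-by 0≤rest (trans (cong (_- entry v) (sum≡f+sumExcept v entry))
                 (solve 2 (λ x y → (x :+ y) :- x := y) refl (entry v) (sumExcept v entry))))
        (≤-reflexive d≡0))))
      where
      0≤rest : 0# ≤ sumExcept v entry
      0≤rest = 0≤sum 0≤if
        where
        0≤if : ∀ w → 0# ≤ (if does (v Fin.≟ w) then 0# else entry w)
        0≤if w with does (v Fin.≟ w)
        ... | true  = ≤-refl
        ... | false = 0≤entry w

  module _ {n} (O : Oracle n) (δ : ℝ) where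
    open Oracle O
    open Run O

    queries-vertex : ∀ (u : Fin n) next → queries (vertex (toℕ u) next) ≡
                     suc (queries (next (Δᵒᵘᵗ S u) (dᵒᵘᵗ S u) (S u u) (b u)))
    queries-vertex u next rewrite toVertex-toℕ u = refl

    queries-walk-≤ : ∀ (u : Fin n) next Q → queries (next nothing) ℕ.≤ Q →
                     (∀ v → queries (next (just (toℕ v , S u v))) ℕ.≤ Q) →
                     queries (walk (toℕ u) next) ℕ.≤ suc Q
    queries-walk-≤ u next Q p q rewrite toVertex-toℕ u with outNeighbours S u
    ... | []     = ℕ.s≤s p
    ... | v ∷ vs = ℕ.s≤s (max≤v⁺ ℕ.z≤n (All.map⁺ (All.universal q (v ∷ vs))))

    queries-walkEstimate : ∀ T (u : Fin n) next Q → (∀ x → queries (next x) ℕ.≤ Q) →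
                           queries (walkEstimate δ T (toℕ u) next) ℕ.≤ T ℕ.* 2 ℕ.+ Q
    queries-walkEstimate zero    u next Q p = p 0#
    queries-walkEstimate (suc T) u next Q p =
      subst (ℕ._≤ suc T ℕ.* 2 ℕ.+ Q) (sym (queries-vertex u _)) (ℕ.s≤s (queries-walk-≤ u _ _
        -- A walk that ends early, at a vertex without out-neighbours, leaves the queries of its
        -- remaining `T` steps unspent.
        (ℕ.≤-trans (p _) (ℕ.m≤n+m Q (T ℕ.* 2)))
        (λ v → queries-walkEstimate T v _ Q (λ x → p _))))

    queries-sumEstimates : ∀ T (u : Fin n) N y next Q → (∀ x → queries (next x) ℕ.≤ Q) →
                           queries (sumEstimates δ T (toℕ u) N y next) ℕ.≤ N ℕ.* (T ℕ.* 2) ℕ.+ Q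
    queries-sumEstimates T u zero    y next Q p = p y
    queries-sumEstimates T u (suc N) y next Q p =
      subst (queries (sumEstimates δ T (toℕ u) (suc N) y next) ℕ.≤_) (sym (ℕ.+-assoc (T ℕ.* 2) _ Q))
        (queries-walkEstimate T u _ _ (λ x → queries-sumEstimates T u N (y + x) next Q p))

    0≤walkProbability : ∀ u v → 0# ≤ walkProbability u v
    0≤walkProbability u v with u Fin.≟ v | S u v ≟ 0#
    ... | yes _  | _        = ≤-refl
    ... | no _   | yes _    = ≤-refl
    ... | no u≢v | no Suv≢0 = *-nonNeg (0≤∣x∣ (S u v))
      (proj₁ (0<⁻¹ (0≤sum (0≤entry S u) , Edge⇒dᵒᵘᵗ≢0 S u (u≢v , Suv≢0) ∘ sym)))

    -- Importance sampling: the probability contributes `1 / d` and the weight `d`, and sign times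
    -- absolute value restores `S u v`. The constants `A` and `C` admit the affine functions that
    -- are carried back along the walk; the `A` term needs that the probabilities sum to 1.
    walk-mean : ∀ u → dᵒᵘᵗ S u ≢ 0# → ∀ A C (x : Vector ℝ n) →
      sum (λ v → walkProbability u v * (A + C * (sgn (S u v) * dᵒᵘᵗ S u * x v))) ≡ A + C * off S b δ x u
    walk-mean u d≢0 A C x = begin
      sum (λ v → walkProbability u v * (A + C * (sgn (S u v) * d * x v)))
        ≡⟨ sum-cong-≗ eq ⟩
      sum (λ v → entry v * (d ⁻¹ * A) + C * term v)
        ≡⟨ ∑-distrib-+ (λ v → entry v * (d ⁻¹ * A)) (λ v → C * term v) ⟩
      sum (λ v → entry v * (d ⁻¹ * A)) + sum (λ v → C * term v)
        ≡⟨ cong₂ _+_ (*-distribʳ-sum (d ⁻¹ * A) entry) (*-distribˡ-sum C term) ⟨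
      d * (d ⁻¹ * A) + C * off S b δ x u
        ≡⟨ cong (_+ C * off S b δ x u) (d*d⁻¹* A) ⟩
      A + C * off S b δ x u ∎
      where
      d = dᵒᵘᵗ S u
      entry term : Vector ℝ n
      entry v = if does (u Fin.≟ v) then 0# else ∣ S u v ∣
      term  v = if does (u Fin.≟ v) then 0# else S u v * x v
      d*d⁻¹* : ∀ y → d * (d ⁻¹ * y) ≡ y
      d*d⁻¹* y = begin
        d * (d ⁻¹ * y)   ≡⟨ solve 3 (λ d e y → d :* (e :* y) := d :* e :* y) refl d (d ⁻¹) y ⟩
        d * d ⁻¹ * y     ≡⟨ cong (_* y) (*-inverseʳ d≢0) ⟩
        1# * y           ≡⟨ solve 1 (λ y → lit 1 :* y := y) refl y ⟩
        y                ∎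
      eq : ∀ v → walkProbability u v * (A + C * (sgn (S u v) * d * x v)) ≡ entry v * (d ⁻¹ * A) + C * term v
      eq v with u Fin.≟ v | S u v ≟ 0#
      ... | yes _ | _ = solve 3 (λ p q c → lit 0 :* p := lit 0 :* q :+ c :* lit 0) refl _ (d ⁻¹ * A) C
      ... | no  _ | yes Suv≡0 = begin
        0# * _                                    ≡⟨ solve 4 (λ p q c x → lit 0 :* p := lit 0 :* q :+ c :* (lit 0 :* x)) refl _ (d ⁻¹ * A) C (x v) ⟩
        0# * (d ⁻¹ * A) + C * (0# * x v)          ≡⟨ cong₂ (λ p q → p * (d ⁻¹ * A) + C * (q * x v)) (0≤x⇒∣x∣≡x ≤-refl) refl ⟨
        ∣ 0# ∣ * (d ⁻¹ * A) + C * (0# * x v)      ≡⟨ cong (λ y → ∣ y ∣ * (d ⁻¹ * A) + C * (y * x v)) Suv≡0 ⟨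
        ∣ S u v ∣ * (d ⁻¹ * A) + C * (S u v * x v) ∎
      ... | no  _ | no  _ = begin
        ∣ S u v ∣ / d * (A + C * (sgn (S u v) * d * x v))
          ≡⟨ solve 7 (λ a e A C s d x → a :* e :* (A :+ C :* (s :* d :* x)) := a :* (e :* A) :+ C :* ((d :* (e :* (s :* a))) :* x))
               refl (∣ S u v ∣) (d ⁻¹) A C (sgn (S u v)) d (x v) ⟩
        ∣ S u v ∣ * (d ⁻¹ * A) + C * (d * (d ⁻¹ * (sgn (S u v) * ∣ S u v ∣)) * x v)
          ≡⟨ cong (λ y → ∣ S u v ∣ * (d ⁻¹ * A) + C * (y * x v)) (trans (d*d⁻¹* _) (sym (x≡sgn*∣x∣ (S u v)))) ⟩
        ∣ S u v ∣ * (d ⁻¹ * A) + C * (S u v * x v) ∎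

    module _ {P : Pred ℝ 0ℓ} (P? : Decidable P) where

      probability-vertex : ∀ (u : Fin n) next → probability P? (vertex (toℕ u) next) ≡
                           probability P? (next (Δᵒᵘᵗ S u) (dᵒᵘᵗ S u) (S u u) (b u))
      probability-vertex u next rewrite toVertex-toℕ u = refl

      probability-walk-[] : ∀ (u : Fin n) next → outNeighbours S u ≡ [] →
                            probability P? (walk (toℕ u) next) ≡ probability P? (next nothing)
      probability-walk-[] u next eq rewrite toVertex-toℕ u | eq = refl

      probability-walk-∷ : ∀ (u : Fin n) next {w ws} → outNeighbours S u ≡ w ∷ ws →
        probability P? (walk (toℕ u) next) ≡
        sum (λ v → walkProbability u v * probability P? (next (just (toℕ v , S u v))))
      probability-walk-∷ u next eq rewrite toVertex-toℕ u | eq = refl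

      module _ (dominant : DiagonallyDominant S) (0<δ : 0# < δ)
               {X : ℝ} (0≤X : 0# ≤ X) (∣b∣≤δX : ∀ i → ∣ b i ∣ ≤ δ * X) where

        private
          W = w S b δ
          D′ = D S b δ

        -- That W T u is the mean of the estimate and X a bound for it, tested on affine minorants.
        probability-walkEstimate : ∀ T (u : Fin n) next α β →
          (∀ x → ∣ x ∣ ≤ X → α + β * x ≤ probability P? (next x)) →
          α + β * W T u ≤ probability P? (walkEstimate δ T (toℕ u) next)
        probability-walkEstimate zero u next α β p = p 0# (subst (_≤ X) (sym (0≤x⇒∣x∣≡x ≤-refl)) 0≤X)
        probability-walkEstimate (suc T) u next α β p =
          subst (α + β * W (suc T) u ≤_) (sym (probability-vertex u _)) (afterVertex (outNeighbours S u) refl)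
          where
          d = dᵒᵘᵗ S u

          step : Maybe (ℕ × ℝ) → Algorithm
          step = maybe′ (λ (v , s) → walkEstimate δ T v (λ x → next ((b u - sgn s * d * x) / D′ u)))
                        (next (b u / D′ u))

          -- The bound `X` reproduces itself: `δ * X` from `b` and `∣ S u u ∣ * X` from the
          -- neighbour add up to the absolute value of the pivot times `X`.
          inSupport : ∀ {g} → ∣ g ∣ ≤ ∣ S u u ∣ * X → ∣ (b u - g) / D′ u ∣ ≤ X
          inSupport {g} q = D-cancel S b δ dominant 0<δ u (subst₂ _≤_
            (cong ∣_∣ (sym (trans (solve 2 (λ x y → x :* y := y :* x) refl (D′ u) _) (/-*-cancel _ (D≢0 S b δ dominant 0<δ u)))))
            (solve 3 (λ d x a → d :* x :+ a :* x := (a :+ d) :* x) refl δ X (∣ S u u ∣))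
            (≤-trans (∣x-y∣≤∣x∣+∣y∣ (b u) g) (+-mono-≤ (∣b∣≤δX u) q)))

          afterVertex : ∀ vs → outNeighbours S u ≡ vs →
                        α + β * W (suc T) u ≤ probability P? (walk (toℕ u) step)
          afterVertex [] eq = subst₂ _≤_
            (cong (λ y → α + β * (y / D′ u)) (begin
              b u                 ≡⟨ solve 1 (λ b → b := b :- lit 0) refl (b u) ⟩
              b u - 0#            ≡⟨ cong (λ o → b u - o) off≡0 ⟨
              b u - off S b δ (W T) u ∎))
            (sym (probability-walk-[] u step eq))
            (p (b u / D′ u) (subst (λ y → ∣ y / D′ u ∣ ≤ X) (solve 1 (λ b → b :- lit 0 := b) refl (b u))
              (inSupport (subst (_≤ ∣ S u u ∣ * X) (sym (0≤x⇒∣x∣≡x ≤-refl)) (*-nonNeg (0≤∣x∣ (S u u)) 0≤X)))))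
            where
            off≡0 : off S b δ (W T) u ≡ 0#
            off≡0 = sum-zero term≡0
              where
              term≡0 : ∀ v → (if does (u Fin.≟ v) then 0# else S u v * W T v) ≡ 0#
              term≡0 v with u Fin.≟ v | S u v ≟ 0#
              ... | yes _  | _         = refl
              ... | no _   | yes Suv≡0 = trans (cong (_* W T v) Suv≡0) (solve 1 (λ x → lit 0 :* x := lit 0) refl _)
              ... | no u≢v | no Suv≢0  = contradiction (u≢v , Suv≢0) (noEdge S u eq v)
          afterVertex (v₀ ∷ vs) eq = subst₂ _≤_ mean (sym (probability-walk-∷ u step eq))
            (sum-mono-≤ (λ v → *-monoˡ-≤ (0≤walkProbability u v) (subst (_≤ probability P? (step (just (toℕ v , S u v))))
              (solve 6 (λ α β b e g w → (α :+ β :* (b :* e)) :+ (:- (β :* e) :* g) :* w := (α :+ β :* (b :* e)) :+ :- (β :* e) :* (g :* w))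
                refl α β (b u) (D′ u ⁻¹) (sgn (S u v) * d) (W T v))
              -- The induction hypothesis is used for the given affine function composed with the
              -- map from the neighbour's value to the value at `u`, which is affine again.
              (probability-walkEstimate T v _ (α + β * (b u * D′ u ⁻¹)) (- (β * D′ u ⁻¹) * (sgn (S u v) * d))
                (λ x ∣x∣≤X → subst (_≤ probability P? (next ((b u - sgn (S u v) * d * x) / D′ u)))
                  (solve 6 (λ α β b e g x → α :+ β :* ((b :- g :* x) :* e) := (α :+ β :* (b :* e)) :+ (:- (β :* e) :* g) :* x)
                    refl α β (b u) (D′ u ⁻¹) (sgn (S u v) * d) x)
                  (p _ (inSupport (bound v x ∣x∣≤X))))))))
            where
            d≢0 : d ≢ 0#
            d≢0 = Edge⇒dᵒᵘᵗ≢0 S u (firstEdge S u eq)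
            -- The weight `d` of the chosen neighbour is at most `∣ S u u ∣` by dominance, so
            -- reweighting does not inflate the estimate beyond what the pivot can absorb.
            bound : ∀ v x → ∣ x ∣ ≤ X → ∣ sgn (S u v) * d * x ∣ ≤ ∣ S u u ∣ * X
            bound v x ∣x∣≤X = subst (_≤ ∣ S u u ∣ * X)
              (sym (trans (cong ∣_∣ (solve 3 (λ s d x → s :* d :* x := s :* (d :* x)) refl (sgn (S u v)) d x))
                (trans (∣sgn*y∣≡∣y∣ (S u v) _) (trans (∣x*y∣≡∣x∣*∣y∣ d x)
                  (cong (_* ∣ x ∣) (0≤x⇒∣x∣≡x (0≤sum (0≤entry S u))))))))
              (*-mono-≤ (0≤sum (0≤entry S u)) 0≤X (dominant u) ∣x∣≤X)
            mean : sum (λ v → walkProbability u v *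
                     ((α + β * (b u * D′ u ⁻¹)) + - (β * D′ u ⁻¹) * (sgn (S u v) * d * W T v)))
                   ≡ α + β * W (suc T) u
            mean = trans (walk-mean u d≢0 _ _ (W T))
              (solve 5 (λ α β b e o → (α :+ β :* (b :* e)) :+ :- (β :* e) :* o := α :+ β :* ((b :- o) :* e))
                refl α β (b u) (D′ u ⁻¹) (off S b δ (W T) u))

        -- Chebyshev's inequality, through a quadratic minorant of the indicator function.
        probability-sumEstimates : ∀ T (u : Fin n) {l c next} → 0# ≤ l →
          (∀ y → 1# - l * ((y - c) * (y - c)) ≤ probability P? (next y)) →
          ∀ N y → let m = y + fromℕ N * W T u - c in
          1# - l * (m * m + fromℕ N * (X * X)) ≤ probability P? (sumEstimates δ T (toℕ u) N y next)
        probability-sumEstimates T u {l} {c} {next} 0≤l p zero y = subst (_≤ probability P? (next y))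
          (solve 5 (λ l y c w x → lit 1 :- l :* ((y :- c) :* (y :- c)) :=
                     lit 1 :- l :* ((y :+ lit 0 :* w :- c) :* (y :+ lit 0 :* w :- c) :+ lit 0 :* (x :* x)))
            refl l y c (W T u) X)
          (p y)
        probability-sumEstimates T u {l} {c} {next} 0≤l p (suc N) y = ≤-trans
          -- Completing the square at the mean: `a * a + 2 a μ` is the square of `a + μ`, the new
          -- centre, minus `μ * μ`. The dropped term is the gain from bounding the variance by the
          -- second moment.
          (≤-by (*-nonNeg 0≤l (0≤x² μ))
            (solve 6 (λ l y c μ x N →
               let a = y :+ N :* μ :- c
                   m = y :+ (lit 1 :+ N) :* μ :- c
               in (lit 1 :- l :* (a :* a :+ (lit 1 :+ N) :* (x :* x)) :+ :- (lit 2 :* l :* a) :* μ)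
                  :- (lit 1 :- l :* (m :* m :+ (lit 1 :+ N) :* (x :* x))) := l :* (μ :* μ))
              refl l y c μ X (fromℕ N)))
          (probability-walkEstimate T u _ (1# - l * (a * a + fromℕ (suc N) * (X * X))) (- (fromℕ 2 * l * a))
            (λ x ∣x∣≤X → ≤-trans
              -- Expanding the square of `a + x`, only `x * x` is not affine in `x`; it is replaced
              -- by `X * X`, which accounts for the additional summand in the bound.
              (≤-by (*-nonNeg 0≤l (0≤y-x (x²≤y² ∣x∣≤X)))
                (solve 7 (λ l y c μ X N x →
                   let a = y :+ N :* μ :- c
                       m = y :+ x :+ N :* μ :- c
                   in (lit 1 :- l :* (m :* m :+ N :* (X :* X)))
                      :- (lit 1 :- l :* (a :* a :+ (lit 1 :+ N) :* (X :* X)) :+ :- (lit 2 :* l :* a) :* x)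
                      := l :* (X :* X :- x :* x))
                  refl l y c μ X (fromℕ N) x))
              (probability-sumEstimates T u 0≤l p N (y + x))))
          where
          μ = W T u
          a = y + fromℕ N * μ - c

-- Integer rounding, logarithms and geometric decay

least : ∀ {P : Pred ℕ 0ℓ} → Decidable P → ∀ n → P n → ∃ λ m → P m × (∀ {k} → m ≡ suc k → ¬ P k)
least P? zero    p = zero , p , λ ()
least P? (suc n) p with P? n
... | yes q = least P? n q
... | no ¬q = suc n , p , λ { refl → ¬q }

module Rounding (R : Reals) where
  open Reals R
  open Logarithm R
  open FieldProperties orderedField
  open IntegerSolver orderedField
  open import Algebra.Construct.NaturalChoice.Max totalOrder using (maxOperator)
  open import Algebra.Construct.NaturalChoice.MaxOp maxOperator using (x≤x⊔y; x≤y⊔x)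
  open import Algebra.Properties.Semiring.Exp semiring using (^-assocʳ)

  private
    -- The Archimedean witness may be arbitrarily far above `x`, which would ruin the query bound.
    -- Since the order is decidable, one can descend from it until the predecessor fails.
    leastAbove : ∀ x → ∃ λ m → x ≤ fromℕ m × (∀ {k} → m ≡ suc k → ¬ x ≤ fromℕ k)
    leastAbove x = let n , p = archimedean x in least (λ k → x ≤? fromℕ k) n p

    leastPowerAbove : ∀ x → ∃ λ m → x ≤ fromℕ 2 ^ m × (∀ {k} → m ≡ suc k → ¬ x ≤ fromℕ 2 ^ k)
    leastPowerAbove x = let n , p = archimedean x in
      least (λ k → x ≤? fromℕ 2 ^ k) n (≤-trans p (n≤2^n n))

  ⌈_⌉ ⌈log₂_⌉ : ℝ → ℕ
  ⌈ x ⌉     = proj₁ (leastAbove x)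
  ⌈log₂ x ⌉ = proj₁ (leastPowerAbove x)

  x≤⌈x⌉ : ∀ x → x ≤ fromℕ ⌈ x ⌉
  x≤⌈x⌉ x = proj₁ (proj₂ (leastAbove x))

  ⌈x⌉≤1+x : ∀ {x} → 0# ≤ x → fromℕ ⌈ x ⌉ ≤ 1# + x
  ⌈x⌉≤1+x {x} 0≤x with leastAbove x
  ... | zero  , _ , _ = 0≤+ 0≤1 0≤x
  ... | suc k , _ , q = +-monoʳ-≤ 1# (≰⇒≥ (q refl))

  x≤2^⌈log₂x⌉ : ∀ x → x ≤ fromℕ 2 ^ ⌈log₂ x ⌉
  x≤2^⌈log₂x⌉ x = proj₁ (proj₂ (leastPowerAbove x))

  2^k≤x⇒k≤log₂x : ∀ {x} k → fromℕ 2 ^ k ≤ x → fromℕ k ≤ log₂ x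
  2^k≤x⇒k≤log₂x {x} k p with x ≤? 0#
  ... | yes x≤0 = contradiction (≤-trans (1≤2^n k) (≤-trans p x≤0)) (<⇒≱ 0<1)
  ... | no  x≰0 = proj₁ (proj₂ (supremum (BelowLog₂ x) (belowLog₂-nonempty x≰0) (belowLog₂-bounded x≰0)))
    -- The integer `k`, as the fraction `(k - 0) / 1`, is one of the rationals whose supremum is the
    -- logarithm.
    ( k , 0 , 0
    , solve 1 (λ k → k :* (lit 1 :+ lit 0) := k :- lit 0) refl (fromℕ k)
    , subst (fromℕ 2 ^ k ≤_) (solve 1 (λ x → x := x :* lit 1 :* lit 1) refl x) p )

  1≤1⊔log₂ : ∀ x → 1# ≤ 1# ⊔ log₂ x
  1≤1⊔log₂ x = x≤x⊔y 1# (log₂ x)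

  -- The predecessor of the rounded value is at most the logarithm, because its power of 2 does not
  -- exceed `x`; the unit added by rounding is paid for by the `1# ⊔`.
  ⌈log₂x⌉≤ : ∀ x → fromℕ ⌈log₂ x ⌉ ≤ fromℕ 2 * (1# ⊔ log₂ x)
  ⌈log₂x⌉≤ x with leastPowerAbove x
  ... | zero  , _ , _ = *-nonNeg (0≤fromℕ 2) (≤-trans 0≤1 (1≤1⊔log₂ x))
  ... | suc k , _ , q = subst (fromℕ (suc k) ≤_) (sym (two* _))
    (+-mono-≤ (1≤1⊔log₂ x) (≤-trans (2^k≤x⇒k≤log₂x k (≰⇒≥ (q refl))) (x≤y⊔x 1# (log₂ x))))

  -- Bernoulli's inequality, that the `k`-th power of `1 + 1/m` is at least `1 + k/m`, with the
  -- denominators cleared.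
  [m/1+m]^k*[m+k]≤m : ∀ m k → (fromℕ m / fromℕ (suc m)) ^ k * (fromℕ m + fromℕ k) ≤ fromℕ m
  [m/1+m]^k*[m+k]≤m m zero    = ≤-reflexive (solve 1 (λ m → lit 1 :* (m :+ lit 0) := m) refl (fromℕ m))
  [m/1+m]^k*[m+k]≤m m (suc k) = ≤-trans
    (*-cancelˡ-≤ (0<fromℕ m) (≤-by (*-nonNeg (0≤x^n k 0≤ρ) (0≤fromℕ k))
      (trans
        (solve 5 (λ m k p ρ l → l :* (p :* (m :+ k)) :- l :* (ρ :* p :* (m :+ (lit 1 :+ k)))
                             := p :* (l :* (m :+ k) :- (ρ :* l) :* (m :+ (lit 1 :+ k))))
          refl (fromℕ m) (fromℕ k) (ρ ^ k) ρ (fromℕ (suc m)))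
        (trans (cong (λ y → ρ ^ k * (fromℕ (suc m) * (fromℕ m + fromℕ k) - y * (fromℕ m + fromℕ (suc k))))
                 (/-*-cancel (fromℕ m) (0<⇒≢0 (0<fromℕ m))))
          (solve 3 (λ m k p → p :* ((lit 1 :+ m) :* (m :+ k) :- m :* (m :+ (lit 1 :+ k))) := p :* k)
            refl (fromℕ m) (fromℕ k) (ρ ^ k))))))
    ([m/1+m]^k*[m+k]≤m m k)
    where
    ρ = fromℕ m / fromℕ (suc m)
    0≤ρ : 0# ≤ ρ
    0≤ρ = *-nonNeg (0≤fromℕ m) (proj₁ (0<⁻¹ (0<fromℕ m)))

  -- Bernoulli's inequality at exponent `m` says that `m` steps of decay at least halve; this
  -- happens `j` times.
  [m/1+m]^mj*2^j≤1 : ∀ m j → 0# < fromℕ m →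
    (fromℕ m / fromℕ (suc m)) ^ (m ℕ.* j) * fromℕ 2 ^ j ≤ 1#
  [m/1+m]^mj*2^j≤1 m j 0<m = subst (λ y → y * fromℕ 2 ^ j ≤ 1#) (^-assocʳ ρ m j) (powers j)
    where
    ρ = fromℕ m / fromℕ (suc m)
    h = ρ ^ m
    0≤h : 0# ≤ h
    0≤h = 0≤x^n m (*-nonNeg (0≤fromℕ m) (proj₁ (0<⁻¹ (0<fromℕ m))))
    2h≤1 : h * fromℕ 2 ≤ 1#
    2h≤1 = *-cancelˡ-≤ 0<m (subst₂ _≤_
      (solve 2 (λ h m → h :* (m :+ m) := m :* (h :* lit 2)) refl h (fromℕ m))
      (solve 1 (λ m → m := m :* lit 1) refl (fromℕ m))
      ([m/1+m]^k*[m+k]≤m m m))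
    powers : ∀ j → h ^ j * fromℕ 2 ^ j ≤ 1#
    powers zero    = ≤-reflexive (solve 0 (lit 1 :* lit 1 := lit 1) refl)
    powers (suc j) = subst₂ _≤_
      (solve 4 (λ h t p q → h :* t :* (p :* q) := h :* p :* (t :* q)) refl h (fromℕ 2) (h ^ j) (fromℕ 2 ^ j))
      (solve 0 (lit 1 :* lit 1 := lit 1) refl)
      (*-mono-≤ (*-nonNeg 0≤h (0≤fromℕ 2)) 0≤1 2h≤1 (powers j))

-- The algorithm, its parameters and its correctness

module Estimator (R : Reals) where
  open Reals R
  open Logarithm R
  open LinearAlgebra orderedField
  open Queries orderedField
  open FieldProperties orderedField
  open LinearAlgebraProperties orderedField
  open RegularisedJacobi orderedField
  open RandomWalk orderedField
  open Rounding R
  open IntegerSolver orderedField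
  open import Algebra.Properties.Semiring.Exp semiring using (^-homo-*)
  open ≡-Reasoning

  -- With M the largest diagonal entry, the regularisation is δ = M / scale, so
  -- that walks decay by the factor scale / (1 + scale) in each step.
  module Parameters (κ ε : ℝ) where

    scale accuracy : ℕ
    -- The 8 makes `‖S⁻¹‖ δ` at most `ε / 8`, so that the main term of the bias takes up a quarter
    -- of the tolerance.
    scale    = ⌈ fromℕ 8 * (κ / ε) ⌉
    accuracy = ⌈ ε ⁻¹ ⌉

    -- Each `scale` steps halve the decay factor; the two logarithms outweigh the square of `κ / ε`,
    -- and the 8 further halvings outweigh the constant 170 found below. For the count, Chebyshev's
    -- inequality bounds the failure probability by `16 scale² / (walkCount ε²)`, and 48 is 3 times
    -- 16, for a failure probability of 1/3; `accuracy` stands for `1 / ε`.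
    walkLength walkCount : ℕ
    walkLength = scale ℕ.* (⌈log₂ κ / ε ⌉ ℕ.+ ⌈log₂ κ / ε ⌉ ℕ.+ 8)
    walkCount  = 48 ℕ.* (scale ℕ.* scale) ℕ.* (accuracy ℕ.* accuracy)

  estimate : (κ M ε : ℝ) → ℕ → Algorithm
  estimate κ M ε u = sumEstimates (M / fromℕ scale) walkLength u walkCount 0# (λ y → return (y / fromℕ walkCount))
    where open Parameters κ ε

  -- The answer 0 is accurate if `ε` exceeds 1 or `b` vanishes. In all other cases `κ` is at least 1
  -- and `M` positive, on which the analysis of `estimate` relies.
  algorithm : (κ ‖b‖ M ε : ℝ) → ℕ → Algorithm
  algorithm κ ‖b‖ M ε u = if does (ε ≤? 1#) ∧ not (does (‖b‖ ≟ 0#)) then estimate κ M ε u else return 0#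

  -- With `X = κ / ε`, the number of walks is at most `48 (9 X)² (2 / ε)²`; a walk has at most `9 X`
  -- times 12 logarithms steps, of 2 queries each. The powers combine as `X³ / ε² = κ³ / ε⁵`.
  queryConstant : ℝ
  queryConstant = fromℕ 48 * (fromℕ 9 * fromℕ 9) * (fromℕ 2 * fromℕ 2) * (fromℕ 9 * fromℕ 12 * fromℕ 2)

  module Constants (κ ε : ℝ) (1≤κ : 1# ≤ κ) (0<ε : 0# < ε) (ε≤1 : ε ≤ 1#) where
    open Parameters κ ε

    X = κ / ε
    m = fromℕ scale
    q = fromℕ accuracy
    N = fromℕ walkCount

    κ≡Xε : X * ε ≡ κ
    κ≡Xε = /-*-cancel κ (0<⇒≢0 0<ε)

    1≤ε⁻¹ : 1# ≤ ε ⁻¹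
    1≤ε⁻¹ = *-cancelˡ-≤ 0<ε (subst₂ _≤_ (solve 1 (λ e → e := e :* lit 1) refl ε)
      (sym (*-inverseʳ (0<⇒≢0 0<ε))) ε≤1)

    0<ε⁻¹ : 0# < ε ⁻¹
    0<ε⁻¹ = <-≤-trans 0<1 1≤ε⁻¹

    1≤X : 1# ≤ X
    1≤X = subst (_≤ X) (solve 0 (lit 1 :* lit 1 := lit 1) refl) (*-mono-≤ 0≤1 (proj₁ 0<ε⁻¹) 1≤κ 1≤ε⁻¹)

    0≤X : 0# ≤ X
    0≤X = ≤-trans 0≤1 1≤X

    8X≤m : fromℕ 8 * X ≤ m
    8X≤m = x≤⌈x⌉ (fromℕ 8 * X)

    m≤9X : m ≤ fromℕ 9 * X
    m≤9X = ≤-trans (⌈x⌉≤1+x (*-nonNeg (0≤fromℕ 8) 0≤X))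
      (≤-by (0≤y-x 1≤X) (solve 1 (λ x → lit 9 :* x :- (lit 1 :+ lit 8 :* x) := x :- lit 1) refl X))

    0<m : 0# < m
    0<m = <-≤-trans (0<* (0<fromℕ 7) (<-≤-trans 0<1 1≤X)) 8X≤m

    ε⁻¹≤q : ε ⁻¹ ≤ q
    ε⁻¹≤q = x≤⌈x⌉ (ε ⁻¹)

    1≤qε : 1# ≤ q * ε
    1≤qε = subst (_≤ q * ε) (*-inverseˡ (0<⇒≢0 0<ε)) (*-monoʳ-≤ (proj₁ 0<ε) ε⁻¹≤q)

    q≤2ε⁻¹ : q ≤ fromℕ 2 * ε ⁻¹
    q≤2ε⁻¹ = ≤-trans (⌈x⌉≤1+x (proj₁ 0<ε⁻¹))
      (≤-by (0≤y-x 1≤ε⁻¹) (solve 1 (λ x → lit 2 :* x :- (lit 1 :+ x) := x :- lit 1) refl (ε ⁻¹)))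

    N≡ : N ≡ fromℕ 48 * (m * m) * (q * q)
    N≡ = trans (fromℕ-* (48 ℕ.* (scale ℕ.* scale)) _)
      (cong₂ _*_ (trans (fromℕ-* 48 (scale ℕ.* scale)) (cong (fromℕ 48 *_) (fromℕ-* scale scale))) (fromℕ-* accuracy accuracy))

    0<N : 0# < N
    0<N = subst (0# <_) (sym N≡) (0<* (0<* (0<fromℕ 47) (0<* 0<m 0<m)) (0<* 0<q 0<q))
      where
      0<q : 0# < q
      0<q = <-≤-trans 0<ε⁻¹ ε⁻¹≤q

    0≤1+m : 0# ≤ fromℕ (suc scale)
    0≤1+m = proj₁ (0<fromℕ scale)

    ρ = m / fromℕ (suc scale)

    0≤ρ : 0# ≤ ρ
    0≤ρ = *-nonNeg (0≤fromℕ scale) (proj₁ (0<⁻¹ (0<fromℕ scale)))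

    p = ρ ^ walkLength

    0≤p : 0# ≤ p
    0≤p = 0≤x^n walkLength 0≤ρ

    -- 170 is 17 times 10: the 17 is what `biasBound` requires, and `1 + m` is at most `10 X`. The
    -- walk length supplies the larger constant 256.
    170X²p≤1 : fromℕ 170 * (X * X) * p ≤ 1#
    170X²p≤1 = ≤-trans
      (≤-by (*-nonNeg (0≤+ (*-nonNeg (0≤fromℕ 256) (0≤y-x X²≤t²)) (*-nonNeg (0≤fromℕ 86) (0≤x² X))) 0≤p)
        (solve 3 (λ x t p → p :* (t :* t :* lit 2 :^ 8) :- lit 170 :* (x :* x) :* p
                         := (lit 256 :* (t :* t :- x :* x) :+ lit 86 :* (x :* x)) :* p) refl X t p))
      (subst (λ y → p * y ≤ 1#)
        (trans (^-homo-* (fromℕ 2) (ℓ ℕ.+ ℓ) 8) (cong (_* fromℕ 2 ^ 8) (^-homo-* (fromℕ 2) ℓ ℓ)))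
        ([m/1+m]^mj*2^j≤1 scale (ℓ ℕ.+ ℓ ℕ.+ 8) 0<m))
      where
      ℓ = ⌈log₂ X ⌉
      t = fromℕ 2 ^ ℓ
      X²≤t² : X * X ≤ t * t
      X²≤t² = *-mono-≤ 0≤X (≤-trans 0≤X (x≤2^⌈log₂x⌉ X)) (x≤2^⌈log₂x⌉ X) (x≤2^⌈log₂x⌉ X)

    17κ[1+m]p≤ε : fromℕ 17 * κ * (fromℕ (suc scale) * p) ≤ ε
    17κ[1+m]p≤ε = ≤-trans
      (*-monoˡ-≤ (*-nonNeg (0≤fromℕ 17) (≤-trans 0≤1 1≤κ)) (*-monoʳ-≤ 0≤p 1+m≤10X))
      (subst₂ _≤_
        (trans (solve 3 (λ x p e → lit 170 :* (x :* x) :* p :* e := lit 17 :* (x :* e) :* (lit 10 :* x :* p)) refl X p ε)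
          (cong (λ y → fromℕ 17 * y * (fromℕ 10 * X * p)) κ≡Xε))
        (solve 1 (λ e → lit 1 :* e := e) refl ε)
        (*-monoʳ-≤ (proj₁ 0<ε) 170X²p≤1))
      where
      1+m≤10X : fromℕ (suc scale) ≤ fromℕ 10 * X
      1+m≤10X = ≤-by (0≤+ (0≤y-x 1≤X) (0≤y-x m≤9X))
        (solve 2 (λ x m → lit 10 :* x :- (lit 1 :+ m) := (x :- lit 1) :+ (lit 9 :* x :- m)) refl X m)

    -- The tolerance is shared in halves. The term free of `Y` is `4 β Z`, at most `ε Z / 2`. The
    -- others are `2 Y (β + 1 + κ)`, at most `(17 / 4) κ Y` since `β` is at most `ε / 8`, hence at
    -- most `κ / 8`, and 1 is at most `κ`; by the choice of the walk length this is at most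
    -- `ε Z / 2` too.
    biasBound : ∀ {β Z} → 0# ≤ Z → 0# ≤ β → fromℕ 8 * β ≤ ε →
      let Y = fromℕ (suc scale) * (p * (fromℕ 2 * Z)) in
      fromℕ 2 * (β * (fromℕ 2 * Z + Y) + (1# + κ) * Y) ≤ ε * Z
    biasBound {β} {Z} 0≤Z 0≤β 8β≤ε = *-cancelˡ-≤ (0<fromℕ 7) (≤-by
      (0≤+ (0≤+ (0≤+ (*-nonNeg (*-nonNeg (0≤fromℕ 2) (0≤+ (*-nonNeg (0≤fromℕ 2) 0≤Z) 0≤Y)) (0≤y-x 8β≤ε))
                     (*-nonNeg (*-nonNeg (0≤fromℕ 2) 0≤Y) (0≤y-x (≤-trans ε≤1 1≤κ))))
                (*-nonNeg (*-nonNeg (0≤fromℕ 16) 0≤Y) (0≤y-x 1≤κ)))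
           (*-nonNeg (*-nonNeg (0≤fromℕ 4) 0≤Z) (0≤y-x 17κ[1+m]p≤ε)))
      (solve 6 (λ β Z l p κ ε →
        let Y = l :* (p :* (lit 2 :* Z)) in
        lit 8 :* (ε :* Z) :- lit 8 :* (lit 2 :* (β :* (lit 2 :* Z :+ Y) :+ (lit 1 :+ κ) :* Y))
        := ((lit 2 :* (lit 2 :* Z :+ Y)) :* (ε :- lit 8 :* β)
            :+ (lit 2 :* Y) :* (κ :- ε))
           :+ (lit 16 :* Y) :* (κ :- lit 1)
           :+ (lit 4 :* Z) :* (ε :- lit 17 :* κ :* (l :* p)))
        refl β Z (fromℕ (suc scale)) p κ ε))
      where
      0≤Y = *-nonNeg 0≤1+m (*-nonNeg 0≤p (*-nonNeg (0≤fromℕ 2) 0≤Z))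

    ε⁻⁵ : (ε ^ 5) ⁻¹ ≡ (ε ⁻¹) ^ 5
    ε⁻⁵ = begin
      (ε ^ 5) ⁻¹                            ≡⟨ solve 1 (λ y → y := y :* lit 1 :^ 5) refl ((ε ^ 5) ⁻¹) ⟩
      (ε ^ 5) ⁻¹ * 1# ^ 5                   ≡⟨ cong (λ y → (ε ^ 5) ⁻¹ * y ^ 5) (*-inverseʳ (0<⇒≢0 0<ε)) ⟨
      (ε ^ 5) ⁻¹ * (ε * ε ⁻¹) ^ 5           ≡⟨ solve 3 (λ y e f → y :* (e :* f) :^ 5 := y :* e :^ 5 :* f :^ 5) refl ((ε ^ 5) ⁻¹) ε (ε ⁻¹) ⟩
      (ε ^ 5) ⁻¹ * ε ^ 5 * (ε ⁻¹) ^ 5       ≡⟨ cong (_* (ε ⁻¹) ^ 5) (*-inverseˡ (0<⇒≢0 (0<^ 5 0<ε))) ⟩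
      1# * (ε ⁻¹) ^ 5                       ≡⟨ solve 1 (λ y → lit 1 :* y := y) refl ((ε ⁻¹) ^ 5) ⟩
      (ε ⁻¹) ^ 5                            ∎

    queryBound : fromℕ (walkCount ℕ.* (walkLength ℕ.* 2) ℕ.+ 0) ≤
                 queryConstant * (κ ^ 3 / ε ^ 5 * (1# ⊔ log₂ (κ / ε)))
    queryBound = subst₂ _≤_ (sym total≡) bound≡
      (*-mono-≤ 0≤N′ 0≤ub (*-mono-≤ 0≤48m² 0≤q²ub (*-monoˡ-≤ (0≤fromℕ 48) (*-mono-≤ 0≤m 0≤9X m≤9X m≤9X))
                                   (*-mono-≤ 0≤q (*-nonNeg (0≤fromℕ 2) (proj₁ 0<ε⁻¹)) q≤2ε⁻¹ q≤2ε⁻¹))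
        (*-monoʳ-≤ (0≤fromℕ 2) (*-mono-≤ 0≤m 0≤12Λ m≤9X l≤12Λ)))
      where
      ℓ = ⌈log₂ X ⌉
      Λ = 1# ⊔ log₂ X
      l = fromℕ (ℓ ℕ.+ ℓ ℕ.+ 8)
      0≤m   = 0≤fromℕ scale
      0≤q   = 0≤fromℕ accuracy
      0≤9X  = *-nonNeg (0≤fromℕ 9) 0≤X
      0≤12Λ : 0# ≤ fromℕ 12 * Λ
      0≤12Λ = *-nonNeg (0≤fromℕ 12) (≤-trans 0≤1 (1≤1⊔log₂ X))
      0≤48m² = *-nonNeg (0≤fromℕ 48) (*-nonNeg 0≤m 0≤m)
      0≤q²ub = *-nonNeg (*-nonNeg (0≤fromℕ 2) (proj₁ 0<ε⁻¹)) (*-nonNeg (0≤fromℕ 2) (proj₁ 0<ε⁻¹))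
      0≤N′   = *-nonNeg 0≤48m² (*-nonNeg 0≤q 0≤q)
      0≤ub   = *-nonNeg (*-nonNeg 0≤9X 0≤12Λ) (0≤fromℕ 2)
      l≤12Λ : l ≤ fromℕ 12 * Λ
      l≤12Λ = subst (_≤ fromℕ 12 * Λ) (sym (trans (fromℕ-+ (ℓ ℕ.+ ℓ) 8) (cong (_+ fromℕ 8) (fromℕ-+ ℓ ℓ))))
        (≤-by (0≤+ (0≤+ (0≤y-x (⌈log₂x⌉≤ X)) (0≤y-x (⌈log₂x⌉≤ X))) (*-nonNeg (0≤fromℕ 8) (0≤y-x (1≤1⊔log₂ X))))
          (solve 2 (λ Λ l → lit 12 :* Λ :- (l :+ l :+ lit 8) :=
                            (lit 2 :* Λ :- l) :+ (lit 2 :* Λ :- l) :+ lit 8 :* (Λ :- lit 1)) refl Λ (fromℕ ℓ)))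
      total≡ : fromℕ (walkCount ℕ.* (walkLength ℕ.* 2) ℕ.+ 0) ≡
               fromℕ 48 * (m * m) * (q * q) * (m * l * fromℕ 2)
      total≡ = begin
        fromℕ (walkCount ℕ.* (walkLength ℕ.* 2) ℕ.+ 0)   ≡⟨ cong fromℕ (ℕ.+-identityʳ (walkCount ℕ.* (walkLength ℕ.* 2))) ⟩
        fromℕ (walkCount ℕ.* (walkLength ℕ.* 2))         ≡⟨ fromℕ-* walkCount (walkLength ℕ.* 2) ⟩
        N * fromℕ (walkLength ℕ.* 2)
          ≡⟨ cong₂ _*_ N≡ (trans (fromℕ-* walkLength 2) (cong (_* fromℕ 2) (fromℕ-* scale (ℓ ℕ.+ ℓ ℕ.+ 8)))) ⟩
        fromℕ 48 * (m * m) * (q * q) * (m * l * fromℕ 2) ∎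
      bound≡ : fromℕ 48 * (fromℕ 9 * X * (fromℕ 9 * X)) * (fromℕ 2 * ε ⁻¹ * (fromℕ 2 * ε ⁻¹)) *
                 (fromℕ 9 * X * (fromℕ 12 * Λ) * fromℕ 2)
               ≡ queryConstant * (κ ^ 3 / ε ^ 5 * Λ)
      bound≡ = trans
        (solve 7 (λ k e Λ c48 c9 c2 c12 →
          c48 :* (c9 :* (k :* e) :* (c9 :* (k :* e))) :* (c2 :* e :* (c2 :* e)) :* (c9 :* (k :* e) :* (c12 :* Λ) :* c2)
          := c48 :* (c9 :* c9) :* (c2 :* c2) :* (c9 :* c12 :* c2) :* (k :^ 3 :* e :^ 5 :* Λ))
          refl κ (ε ⁻¹) Λ (fromℕ 48) (fromℕ 9) (fromℕ 2) (fromℕ 12))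
        (cong (λ y → queryConstant * (κ ^ 3 * y * Λ)) (sym ε⁻⁵))

  -- Guarantees on a fixed instance

  module _ {n} (O : Oracle n) where
    open Oracle O
    open Run O

    module _
      (dominant : DiagonallyDominant S)
      (condition : NonSingular S ⊎ NonZeroDiagonalOfOneSign S)
      (b∈range : InRange S b)
      (B : Matrix n) (S⁻¹≡B : InverseOrPseudoInverse S B) where

      z : Vector ℝ n
      z = B ·ᵥ b

      Z = ‖ z ‖ᵥ
      M = maxDiagonal S

      Sz≡b : ∀ i → (S ·ᵥ z) i ≡ b i
      Sz≡b i = let x , Sx≡b = b∈range in begin
        (S ·ᵥ (B ·ᵥ b)) i          ≡⟨ ·ᵥ-congʳ S (·ᵥ-congʳ B Sx≡b) i ⟨
        (S ·ᵥ (B ·ᵥ (S ·ᵥ x))) i   ≡⟨ ABA≡A S⁻¹≡B x i ⟩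
        (S ·ᵥ x) i                 ≡⟨ Sx≡b i ⟩
        b i                        ∎

      BSz≡z : ∀ i → (B ·ᵥ (S ·ᵥ z)) i ≡ z i
      BSz≡z = ·ᵥ-congʳ B Sz≡b

      0≤‖S‖ : 0# ≤ ‖ S ‖
      0≤‖S‖ = 0≤‖x‖ (λ i → sum (λ j → ∣ S i j ∣))

      0≤‖B‖ : 0# ≤ ‖ B ‖
      0≤‖B‖ = 0≤‖x‖ (λ i → sum (λ j → ∣ B i j ∣))

      0≤κ : 0# ≤ κ S B
      0≤κ = *-nonNeg 0≤‖S‖ 0≤‖B‖

      0≤Z : 0# ≤ Z
      0≤Z = 0≤‖x‖ z

      ∣S∣≤M : ∀ i → ∣ S i i ∣ ≤ M
      ∣S∣≤M = ∣x∣≤‖x‖ (λ i → S i i)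

      M≤‖S‖ : M ≤ ‖ S ‖
      M≤‖S‖ = ‖x‖≤ 0≤‖S‖ λ i → ≤-trans
        (≤-by (0≤off i) (trans (cong (_- ∣ S i i ∣) (sum≡f+sumExcept i (λ j → ∣ S i j ∣)))
          (solve 2 (λ x y → (x :+ y) :- x := y) refl (∣ S i i ∣) (offDiagonalSum S i))))
        (rowSum≤‖A‖ S i)
        where
        0≤off : ∀ i → 0# ≤ offDiagonalSum S i
        0≤off i = 0≤sum (0≤entry S i)

      ‖S‖≤2M : ‖ S ‖ ≤ fromℕ 2 * M
      ‖S‖≤2M = ‖x‖≤ (*-nonNeg (0≤fromℕ 2) 0≤M) λ i →
        subst (_≤ fromℕ 2 * M) (sym (0≤x⇒∣x∣≡x (0≤sum (λ j → 0≤∣x∣ (S i j)))))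
          (subst₂ _≤_ (sym (sum≡f+sumExcept i (λ j → ∣ S i j ∣))) (sym (two* M))
            (+-mono-≤ (∣S∣≤M i) (≤-trans (dominant i) (∣S∣≤M i))))
        where
        0≤M : 0# ≤ M
        0≤M = 0≤‖x‖ (λ i → S i i)

      ‖b‖≡0⇒z≡0 : ‖ b ‖ᵥ ≡ 0# → ∀ i → z i ≡ 0#
      ‖b‖≡0⇒z≡0 ‖b‖≡0 i = ∣x∣≤0⇒x≡0 (subst (∣ z i ∣ ≤_) (solve 1 (λ x → x :* lit 0 := lit 0) refl (‖ B ‖))
        (∣Ax∣≤ B ≤-refl (λ j → subst (∣ b j ∣ ≤_) ‖b‖≡0 (∣x∣≤‖x‖ b j)) i))

      ∣b∣≤2∣S∣Z : ∀ i → ∣ b i ∣ ≤ ∣ S i i ∣ * (fromℕ 2 * Z)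
      ∣b∣≤2∣S∣Z i = subst₂ _≤_
        (cong ∣_∣ (trans (sym (sum≡f+sumExcept i (λ j → S i j * z j))) (Sz≡b i)))
        (solve 2 (λ s z → s :* z :+ s :* z := s :* (lit 2 :* z)) refl (∣ S i i ∣) Z)
        (≤-trans (∣x+y∣≤∣x∣+∣y∣ _ _) (+-mono-≤
          (subst (_≤ ∣ S i i ∣ * Z) (sym (∣x*y∣≡∣x∣*∣y∣ (S i i) (z i))) (*-monoˡ-≤ (0≤∣x∣ (S i i)) (∣x∣≤‖x‖ z i)))
          -- No shift has been chosen yet; `1#` stands in as a positive value.
          (∣off∣≤ S b 1# dominant 0<1 0≤Z (∣x∣≤‖x‖ z) i)))

      indicator : ∀ {P : Pred ℝ 0ℓ} (P? : Decidable P) x {a} → a ≤ 1# → (¬ P x → a ≤ 0#) →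
                  a ≤ (if does (P? x) then 1# else 0#)
      indicator P? x a≤1 a≤0 with P? x
      ... | yes _  = a≤1
      ... | no  ¬p = a≤0 ¬p

      module _ (‖b‖≢0 : ‖ b ‖ᵥ ≢ 0#) where

        private
          0<‖b‖ : 0# < ‖ b ‖ᵥ
          0<‖b‖ = 0≤‖x‖ b , ‖b‖≢0 ∘ sym

          ∣b∣≤‖S‖Z : ∀ {a} → 0# ≤ a → (∀ j → ∣ z j ∣ ≤ a) → ‖ b ‖ᵥ ≤ ‖ S ‖ * a
          ∣b∣≤‖S‖Z 0≤a q = ‖x‖≤ (*-nonNeg 0≤‖S‖ 0≤a) λ i →
            subst (λ y → ∣ y ∣ ≤ ‖ S ‖ * _) (Sz≡b i) (∣Ax∣≤ S 0≤a q i)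

        -- Although `S · B` need not be the identity, it fixes `b`, so the norm of `b` is at most
        -- `κ` times itself and can be cancelled.
        1≤κ : 1# ≤ κ S B
        1≤κ = *-cancelˡ-≤ 0<‖b‖ (subst₂ _≤_ (solve 1 (λ x → x := x :* lit 1) refl _)
          (solve 3 (λ s t b → s :* (t :* b) := b :* (s :* t)) refl (‖ S ‖) (‖ B ‖) (‖ b ‖ᵥ))
          (∣b∣≤‖S‖Z (*-nonNeg 0≤‖B‖ (0≤‖x‖ b)) (∣Ax∣≤ B (0≤‖x‖ b) (∣x∣≤‖x‖ b))))

        0<Z : 0# < Z
        0<Z = ≰⇒< λ Z≤0 → <⇒≱ 0<‖b‖ (subst (‖ b ‖ᵥ ≤_) (solve 1 (λ s → s :* lit 0 := lit 0) refl (‖ S ‖))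
          (∣b∣≤‖S‖Z ≤-refl (λ j → ≤-trans (∣x∣≤‖x‖ z j) Z≤0)))

        -- By dominance a vanishing diagonal would force `S` to vanish, and `κ` with it.
        0<M : 0# < M
        0<M = ≰⇒< λ M≤0 → <⇒≱ 0<1 (≤-trans 1≤κ (≤-trans
          (*-monoʳ-≤ 0≤‖B‖ (≤-trans ‖S‖≤2M (*-monoˡ-≤ (0≤fromℕ 2) M≤0)))
          (≤-reflexive (solve 2 (λ t b → t :* lit 0 :* b := lit 0) refl (fromℕ 2) (‖ B ‖)))))

        module _ {ε : ℝ} (0<ε : 0# < ε) (ε≤1 : ε ≤ 1#) where
          open Parameters (κ S B) ε
          private
            m = fromℕ scale
            N = fromℕ walkCount
            δ = M / m
            module K = Constants (κ S B) ε 1≤κ 0<ε ε≤1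
            μ = w S b δ walkLength

            δm≡M : δ * m ≡ M
            δm≡M = /-*-cancel M (0<⇒≢0 K.0<m)

            0<δ : 0# < δ
            0<δ = 0<* 0<M (0<⁻¹ K.0<m)

            ∣S∣≤δm : ∀ i → ∣ S i i ∣ ≤ δ * m
            ∣S∣≤δm i = subst (∣ S i i ∣ ≤_) (sym δm≡M) (∣S∣≤M i)

            contractive : ∀ i → ∣ S i i ∣ ≤ K.ρ * (∣ S i i ∣ + δ)
            contractive i = *-cancelˡ-≤ (0<fromℕ scale) (≤-by (0≤y-x (∣S∣≤δm i)) (begin
              l * (K.ρ * (s + δ)) - l * s
                ≡⟨ solve 4 (λ l ρ s d → l :* (ρ :* (s :+ d)) :- l :* s := ρ :* l :* (s :+ d) :- l :* s) refl l K.ρ s δ ⟩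
              K.ρ * l * (s + δ) - l * s
                ≡⟨ cong (λ y → y * (s + δ) - l * s) (/-*-cancel m (0<⇒≢0 (0<fromℕ scale))) ⟩
              m * (s + δ) - (1# + m) * s
                ≡⟨ solve 3 (λ m s d → m :* (s :+ d) :- (lit 1 :+ m) :* s := d :* m :- s) refl m s δ ⟩
              δ * m - s ∎))
              where
              l = fromℕ (suc scale)
              s = ∣ S i i ∣

            D≤ : ∀ i → ∣ S i i ∣ + δ ≤ fromℕ (suc scale) * δ
            D≤ i = ≤-by (0≤y-x (∣S∣≤δm i))
              (solve 3 (λ m s d → (lit 1 :+ m) :* d :- (s :+ d) := d :* m :- s) refl m (∣ S i i ∣) δ)

            8‖B‖δ≤ε : fromℕ 8 * (‖ B ‖ * δ) ≤ ε
            8‖B‖δ≤ε = *-cancelˡ-≤ K.0<m (≤-trans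
              (≤-by (*-nonNeg (*-nonNeg (0≤fromℕ 8) 0≤‖B‖) (0≤y-x (≤-trans (≤-reflexive δm≡M) M≤‖S‖)))
                (solve 4 (λ s b d m → lit 8 :* (s :* b) :- m :* (lit 8 :* (b :* d)) := lit 8 :* b :* (s :- d :* m))
                  refl (‖ S ‖) (‖ B ‖) δ m))
              (subst (_≤ m * ε)
                (trans (solve 2 (λ x e → lit 8 :* x :* e := lit 8 :* (x :* e)) refl K.X ε) (cong (fromℕ 8 *_) K.κ≡Xε))
                (*-monoʳ-≤ (proj₁ 0<ε) K.8X≤m)))

            bias : ∀ i → fromℕ 2 * ∣ μ i - z i ∣ ≤ ε * Z
            bias i = ≤-trans
              (*-monoˡ-≤ (0≤fromℕ 2) (∣w-z∣≤ S b δ dominant 0<δ Sz≡b (∣x∣≤‖x‖ z) 0≤Z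
                K.0≤ρ contractive S⁻¹≡B condition BSz≡z D≤ K.0≤1+m walkLength i))
              (K.biasBound 0≤Z (*-nonNeg 0≤‖B‖ (proj₁ 0<δ)) 8‖B‖δ≤ε)

            -- The bound on a single estimate: `b i` is at most `2 Z` times a diagonal entry, and
            -- diagonal entries are at most `M = δ m`. The factor `m` is the price of a small shift.
            support = m * (fromℕ 2 * Z)

            0≤support : 0# ≤ support
            0≤support = *-nonNeg (proj₁ K.0<m) (*-nonNeg (0≤fromℕ 2) 0≤Z)

            ∣b∣≤ : ∀ i → ∣ b i ∣ ≤ δ * support
            ∣b∣≤ i = ≤-trans (∣b∣≤2∣S∣Z i) (subst (∣ S i i ∣ * (fromℕ 2 * Z) ≤_)
              (solve 3 (λ d m y → d :* m :* y := d :* (m :* y)) refl δ m (fromℕ 2 * Z))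
              (*-monoʳ-≤ (*-nonNeg (0≤fromℕ 2) 0≤Z) (∣S∣≤δm i)))

            t = N * (ε * Z)

            0<t : 0# < t
            0<t = 0<* K.0<N (0<* 0<ε 0<Z)

            0<t² : 0# < t * t
            0<t² = 0<* 0<t 0<t

            -- Chosen so that the parabola `1 - l e²` reaches 0 at `e = t / 2`, the least deviation
            -- of the sum that an inaccurate answer permits.
            l = fromℕ 4 * (t * t) ⁻¹

            0≤l : 0# ≤ l
            0≤l = *-nonNeg (0≤fromℕ 4) (proj₁ (0<⁻¹ 0<t²))

            t²l≡4 : t * t * l ≡ fromℕ 4
            t²l≡4 = trans (solve 2 (λ t i → t :* (lit 4 :* i) := lit 4 :* (t :* i)) refl (t * t) ((t * t) ⁻¹))
              (trans (cong (fromℕ 4 *_) (*-inverseʳ (0<⇒≢0 0<t²))) (solve 0 (lit 4 :* lit 1 := lit 4) refl))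

          module _ (u : Fin n) where

            private
              c = N * μ u

              -- The bias uses at most half of the tolerance `ε Z`, so an inaccurate average differs
              -- from its mean by at least the other half; the factor `N` passes from the average to
              -- the sum.
              far : ∀ y → ¬ Accurate ε z u (y / N) → t ≤ fromℕ 2 * ∣ y - c ∣
              far y inaccurate = ≤-trans
                (*-monoˡ-≤ (proj₁ K.0<N) (≤-by (0≤+ (0≤+ (0≤y-x (bias u)) (*-nonNeg (0≤fromℕ 2) (0≤y-x triangle)))
                                                   (*-nonNeg (0≤fromℕ 2) (0≤y-x (≮⇒≥ (inaccurate ∘ inj₁)))))
                  (solve 4 (λ a e f g → lit 2 :* a :- e := (e :- lit 2 :* f) :+ lit 2 :* ((a :+ f) :- g) :+ lit 2 :* (g :- e))
                    refl (∣ x - μ u ∣) (ε * Z) (∣ μ u - z u ∣) (∣ x - z u ∣))))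
                (≤-reflexive (begin
                  N * (fromℕ 2 * ∣ x - μ u ∣)       ≡⟨ solve 2 (λ N a → N :* (lit 2 :* a) := lit 2 :* (N :* a)) refl N _ ⟩
                  fromℕ 2 * (N * ∣ x - μ u ∣)       ≡⟨ cong (λ y → fromℕ 2 * (y * ∣ x - μ u ∣)) (0≤x⇒∣x∣≡x (proj₁ K.0<N)) ⟨
                  fromℕ 2 * (∣ N ∣ * ∣ x - μ u ∣)   ≡⟨ cong (fromℕ 2 *_) (∣x*y∣≡∣x∣*∣y∣ N _) ⟨
                  fromℕ 2 * ∣ N * (x - μ u) ∣       ≡⟨ cong (λ y → fromℕ 2 * ∣ y ∣)
                    (solve 3 (λ N x m → N :* (x :- m) := x :* N :- N :* m) refl N x (μ u)) ⟩
                  fromℕ 2 * ∣ x * N - c ∣           ≡⟨ cong (λ y → fromℕ 2 * ∣ y - c ∣) (/-*-cancel y (0<⇒≢0 K.0<N)) ⟩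
                  fromℕ 2 * ∣ y - c ∣               ∎))
                where
                x = y / N
                triangle : ∣ x - z u ∣ ≤ ∣ x - μ u ∣ + ∣ μ u - z u ∣
                triangle = subst (λ y → ∣ y ∣ ≤ ∣ x - μ u ∣ + ∣ μ u - z u ∣)
                  (solve 3 (λ x m z → (x :- m) :+ (m :- z) := x :- z) refl x (μ u) (z u)) (∣x+y∣≤∣x∣+∣y∣ _ _)

              minorant : ∀ y → 1# - l * ((y - c) * (y - c)) ≤ probability (accurate? ε z u) (return (y / N))
              minorant y = indicator (accurate? ε z u) (y / N)
                (≤-by (*-nonNeg 0≤l (0≤x² (y - c))) (solve 1 (λ a → lit 1 :- (lit 1 :- a) := a) refl _))
                (λ inaccurate → *-cancelˡ-≤ (0<fromℕ 3) (≤-by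
                  (*-nonNeg 0≤l (0≤y-x (*-mono-≤ (proj₁ 0<t) (0≤2a y) (far y inaccurate) (far y inaccurate))))
                  (begin
                    fromℕ 4 * 0# - fromℕ 4 * (1# - l * ((y - c) * (y - c)))
                      ≡⟨ solve 2 (λ l e → lit 4 :* lit 0 :- lit 4 :* (lit 1 :- l :* e) := l :* (lit 4 :* e) :- lit 4) refl l _ ⟩
                    l * (fromℕ 4 * ((y - c) * (y - c))) - fromℕ 4
                      ≡⟨ cong₂ (λ e f → l * (fromℕ 4 * e) - f) (∣x∣²≡x² (y - c)) t²l≡4 ⟨
                    l * (fromℕ 4 * (∣ y - c ∣ * ∣ y - c ∣)) - t * t * l
                      ≡⟨ solve 3 (λ l a t → l :* (lit 4 :* (a :* a)) :- t :* t :* l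
                                         := l :* (lit 2 :* a :* (lit 2 :* a) :- t :* t)) refl l (∣ y - c ∣) t ⟩
                    l * (fromℕ 2 * ∣ y - c ∣ * (fromℕ 2 * ∣ y - c ∣) - t * t) ∎)))
                where
                0≤2a : ∀ y → 0# ≤ fromℕ 2 * ∣ y - c ∣
                0≤2a y = *-nonNeg (0≤fromℕ 2) (0≤∣x∣ _)

              deviation : fromℕ 3 * (l * (N * (support * support))) ≤ 1#
              deviation = *-cancelˡ-≤ 0<t² (≤-by
                (*-nonNeg (*-nonNeg (*-nonNeg (proj₁ K.0<N) (0≤x² Z)) (*-nonNeg (0≤fromℕ 48) (0≤x² m)))
                  (0≤y-x (*-mono-≤ 0≤1 (≤-trans 0≤1 K.1≤qε) K.1≤qε K.1≤qε)))
                (begin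
                  t * t * 1# - t * t * (fromℕ 3 * (l * (N * (support * support))))
                    ≡⟨ solve 4 (λ t l N s → t :* t :* lit 1 :- t :* t :* (lit 3 :* (l :* (N :* (s :* s))))
                                         := t :* t :- t :* t :* l :* (lit 3 :* (N :* (s :* s)))) refl t l N support ⟩
                  t * t - t * t * l * (fromℕ 3 * (N * (support * support)))
                    ≡⟨ cong (λ y → t * t - y * (fromℕ 3 * (N * (support * support)))) t²l≡4 ⟩
                  t * t - fromℕ 4 * (fromℕ 3 * (N * (support * support)))
                    ≡⟨ solve 4 (λ N ε Z m → let t = N :* (ε :* Z); s = m :* (lit 2 :* Z) in
                                  t :* t :- lit 4 :* (lit 3 :* (N :* (s :* s)))
                               := N :* (Z :* Z) :* (N :* (ε :* ε) :- lit 48 :* (m :* m))) refl N ε Z m ⟩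
                  N * (Z * Z) * (N * (ε * ε) - fromℕ 48 * (m * m))
                    ≡⟨ cong (λ y → N * (Z * Z) * (y * (ε * ε) - fromℕ 48 * (m * m))) K.N≡ ⟩
                  N * (Z * Z) * (fromℕ 48 * (m * m) * (K.q * K.q) * (ε * ε) - fromℕ 48 * (m * m))
                    ≡⟨ solve 5 (λ N Z a q ε → N :* (Z :* Z) :* (a :* (q :* q) :* (ε :* ε) :- a)
                                           := N :* (Z :* Z) :* a :* (q :* ε :* (q :* ε) :- lit 1 :* lit 1))
                         refl N Z (fromℕ 48 * (m * m)) K.q ε ⟩
                  N * (Z * Z) * (fromℕ 48 * (m * m)) * (K.q * ε * (K.q * ε) - 1# * 1#) ∎))

            accuracyProbability : fromℕ 2 / fromℕ 3 ≤ probability (accurate? ε z u) (estimate (κ S B) M ε (toℕ u))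
            accuracyProbability = ≤-trans
              (*-cancelˡ-≤ (0<fromℕ 2) (≤-by (0≤y-x deviation) (begin
                fromℕ 3 * (1# - l * (d * d + N * (support * support))) - fromℕ 3 * (fromℕ 2 / fromℕ 3)
                  ≡⟨ solve 5 (λ l c e N s → let d = lit 0 :+ c :- c in
                       lit 3 :* (lit 1 :- l :* (d :* d :+ N :* (s :* s))) :- lit 3 :* e
                       := (lit 3 :- lit 3 :* (l :* (N :* (s :* s)))) :- e :* lit 3)
                     refl l c (fromℕ 2 / fromℕ 3) N support ⟩
                (fromℕ 3 - a) - fromℕ 2 / fromℕ 3 * fromℕ 3
                  ≡⟨ cong (λ y → (fromℕ 3 - a) - y) (/-*-cancel (fromℕ 2) (0<⇒≢0 (0<fromℕ 2))) ⟩
                (fromℕ 3 - a) - fromℕ 2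
                  ≡⟨ solve 1 (λ a → (lit 3 :- a) :- lit 2 := lit 1 :- a) refl a ⟩
                1# - a ∎)))
              (probability-sumEstimates O δ (accurate? ε z u) dominant 0<δ 0≤support ∣b∣≤ walkLength u
                0≤l minorant walkCount 0#)
              where
              -- The centring term of `probability-sumEstimates`, zero because `c` is the mean of
              -- the whole sum started at 0; only the variance term remains.
              d = 0# + c - c
              a = fromℕ 3 * (l * (N * (support * support)))

      2/3≤1 : fromℕ 2 / fromℕ 3 ≤ 1#
      2/3≤1 = *-cancelˡ-≤ (0<fromℕ 2) (≤-by 0≤1 (begin
        fromℕ 3 * 1# - fromℕ 3 * (fromℕ 2 / fromℕ 3)   ≡⟨ solve 1 (λ x → lit 3 :* lit 1 :- lit 3 :* x := lit 3 :- x :* lit 3) refl _ ⟩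
        fromℕ 3 - fromℕ 2 / fromℕ 3 * fromℕ 3          ≡⟨ cong (λ y → fromℕ 3 - y) (/-*-cancel (fromℕ 2) (0<⇒≢0 (0<fromℕ 2))) ⟩
        fromℕ 3 - fromℕ 2                              ≡⟨ solve 0 (lit 3 :- lit 2 := lit 1) refl ⟩
        1#                                             ∎))

      -- Degenerate cases and the combined guarantee

      module _ {ε : ℝ} (0<ε : 0# < ε) (u : Fin n) where

        bound : ℝ
        bound = queryConstant * (κ S B ^ 3 / ε ^ 5 * (1# ⊔ log₂ (κ S B / ε)))

        0≤bound : 0# ≤ bound
        0≤bound = *-nonNeg
          (*-nonNeg (*-nonNeg (*-nonNeg (0≤fromℕ 48) (*-nonNeg (0≤fromℕ 9) (0≤fromℕ 9))) (*-nonNeg (0≤fromℕ 2) (0≤fromℕ 2)))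
                    (*-nonNeg (*-nonNeg (0≤fromℕ 9) (0≤fromℕ 12)) (0≤fromℕ 2)))
          (*-nonNeg (*-nonNeg (0≤x^n 3 0≤κ) (proj₁ (0<⁻¹ (0<^ 5 0<ε)))) (≤-trans 0≤1 (1≤1⊔log₂ _)))

        zeroAccurate : ¬ ε ≤ 1# ⊎ (∀ i → z i ≡ 0#) → Accurate ε z u 0#
        zeroAccurate (inj₂ z≡0) = inj₂ (z≡0 , subst (_≤ ε * Z)
          (trans (sym (0≤x⇒∣x∣≡x ≤-refl)) (cong ∣_∣ (trans (solve 0 (lit 0 := lit 0 :- lit 0) refl) (cong (λ y → 0# - y) (sym (z≡0 u))))))
          (*-nonNeg (proj₁ 0<ε) 0≤Z))
        zeroAccurate (inj₁ ε≰1) with Z ≟ 0#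
        -- For `Z = 0` the strict inequality fails even though `ε` exceeds 1, so this case goes
        -- through the non-strict alternative.
        ... | yes Z≡0 = zeroAccurate (inj₂ (λ i → ∣x∣≤0⇒x≡0 (subst (∣ z i ∣ ≤_) Z≡0 (∣x∣≤‖x‖ z i))))
        ... | no  Z≢0 = inj₁ (≤-<-trans
          (subst (_≤ Z) (trans (sym (∣-x∣≡∣x∣ (z u))) (cong ∣_∣ (solve 1 (λ x → :- x := lit 0 :- x) refl (z u)))) (∣x∣≤‖x‖ z u))
          (≰⇒< λ εZ≤Z → ε≰1 (*-cancelˡ-≤ (0≤Z , Z≢0 ∘ sym)
            (subst₂ _≤_ (solve 2 (λ e z → e :* z := z :* e) refl ε Z) (solve 1 (λ z → z := z :* lit 1) refl Z) εZ≤Z))))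

        return0 : ¬ ε ≤ 1# ⊎ (∀ i → z i ≡ 0#) →
          (0# ≤ bound) × (fromℕ 2 / fromℕ 3 ≤ probability (accurate? ε z u) (return 0#))
        return0 p = 0≤bound ,
          indicator (accurate? ε z u) 0# 2/3≤1 (λ inaccurate → contradiction (zeroAccurate p) inaccurate)

        correct : let A = algorithm (κ S B) ‖ b ‖ᵥ M ε (toℕ u) in
          (fromℕ (queries A) ≤ bound) × (fromℕ 2 / fromℕ 3 ≤ probability (accurate? ε z u) A)
        correct with ε ≤? 1# | ‖ b ‖ᵥ ≟ 0#
        ... | no  ε≰1 | _         = return0 (inj₁ ε≰1)
        ... | yes _   | yes ‖b‖≡0 = return0 (inj₂ (‖b‖≡0⇒z≡0 ‖b‖≡0))
        ... | yes ε≤1 | no  ‖b‖≢0 =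
          ≤-trans
            (fromℕ-mono (queries-sumEstimates O _ walkLength u walkCount 0# _ 0 (λ _ → ℕ.z≤n)))
            (Constants.queryBound (κ S B) ε (1≤κ ‖b‖≢0) 0<ε ε≤1) ,
          accuracyProbability ‖b‖≢0 0<ε ε≤1 u
          where open Parameters (κ S B) ε

theorem1p7 :
    (R : Reals) →
    let open Reals R
        open Logarithm R
        open LinearAlgebra orderedField
        open Queries orderedField
    in
    Σ[ algorithm ∈ ((κ∞ ‖b‖ S-max ε : ℝ) (u : ℕ) → Algorithm) ]
    Σ[ C ∈ ℝ ]
    (∀ {n : ℕ} (O : Oracle n) →
     let open Oracle O
         open Run O
     in
     DiagonallyDominant S →
     NonSingular S ⊎ (Symmetric S × NonZeroDiagonalOfOneSign S) →
     InRange S b →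
     (S⁻¹ : Matrix n) → InverseOrPseudoInverse S S⁻¹ →
     (ε : ℝ) → 0# < ε →
     (u : Fin n) →
     let κ∞ = κ S S⁻¹
         z* = S⁻¹ ·ᵥ b
         A  = algorithm κ∞ ‖ b ‖ᵥ (maxDiagonal S) ε (toℕ u)
     in
     (fromℕ (queries A) ≤ C * (κ∞ ^ 3 / ε ^ 5 * (1# ⊔ log₂ (κ∞ / ε)))) ×
     (fromℕ 2 / fromℕ 3 ≤ probability (accurate? ε z* u) A))
theorem1p7 R = algorithm , queryConstant ,
  λ O dominant condition b∈range B S⁻¹≡B ε 0<ε u →
    correct O dominant (Sum.map₂ proj₂ condition) b∈range B S⁻¹≡B 0<ε u
  where open Estimator R
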